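{- Let $F$ be a flipclass of $\mathfrak S_n$. For any two reflection orderings $\preceq$ and $\preceq'$ on the transpositions of $\mathfrak S_n$, the number of paths in $F$ that are increasing with respect to $\preceq$ equals the number of paths in $F$ that are increasing with respect to $\preceq'$.
   Context: $\mathfrak S_n$ is the symmetric group on $[n]$, $\ell$ its Coxeter length w.r.t. the simple transpositions, $T$ its set of transpositions. The Bruhat graph $B(\mathfrak S_n)$ has vertex set $\mathfrak S_n$ and an edge $u\xrightarrow{t}v$ labelled $t$ whenever $vu^{ -1}=t\in T$ and $\ell(u)<\ell(v)$. $P_h(u,v)$ is the set of directed paths $u=x_0\to\cdots\to x_h=v$ of length $h$. Between any two elements there are either 0 or 2 paths of length 2; if 2, each is the flip of the other. For $i\in[h-1]$, $f_i:P_h(u,v)\to P_h(u,v)$ replaces the subpath $x_{i-1}\to x_i\to x_{i+1}$ with its flip; a flipclass is an orbit in $P_h(u,v)$ of the group generated by $f_1,\dots,f_{h-1}$. A total order $\preceq$ on $T$ is a reflection ordering if for all $a<b<c$ in $[n]$ either $(a,b)\preceq(a,c)\preceq(b,c)$ or $(b,c)\preceq(a,c)\preceq(a,b)$. A path with successive labels $t_1,\dots,t_h$ is increasing w.r.t. $\preceq$ if $t_1\preceq t_2\preceq\cdots\preceq t_h$. -}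

module Defs where

open import Data.Nat as ℕ using (ℕ; zero; suc)
open import Data.Fin as Fin using (Fin; toℕ)
open import Data.Fin.Properties using (_≟_; <-trans)
import Data.Fin.Properties as FinP
open import Data.Vec as Vec using (Vec; []; _∷_; lookup)
open import Data.List as List using (List; length; filter; cartesianProduct; allFin)
open import Data.Product using (Σ; _×_; _,_; ∃)
open import Data.Sum using (_⊎_)
open import Relation.Nullary using (¬_; yes; no)
open import Relation.Nullary.Decidable using (_×-dec_)
open import Relation.Binary.PropositionalEquality using (_≡_)
open import Relation.Binary.Structures using (IsTotalOrder)
open import Relation.Binary.Construct.Closure.ReflexiveTransitive using (Star)

OneLine : ℕ → Set
OneLine n = Vec (Fin n) n

IsPerm : ∀ {n} → OneLine n → Set
IsPerm {n} u = ∀ (i j : Fin n) → lookup u i ≡ lookup u j → i ≡ j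

-- Coxeter length in S_n w.r.t. simple transpositions = number of inversions.
ℓ : ∀ {n} → OneLine n → ℕ
ℓ {n} u = length (filter (λ ij → let i = Data.Product.proj₁ ij ; j = Data.Product.proj₂ ij in
                                  (i Fin.<? j) ×-dec (lookup u j Fin.<? lookup u i))
                         (cartesianProduct (allFin n) (allFin n)))

record Transp (n : ℕ) : Set where
  constructor tr
  field
    fst : Fin n
    snd : Fin n
    lt  : fst Fin.< snd

swap : ∀ {n} → Fin n → Fin n → Fin n → Fin n
swap a b x with x ≟ a
... | yes _ = b
... | no _ with x ≟ b
...   | yes _ = a
...   | no _ = x

-- left multiplication t·u  (so that v u⁻¹ = t  iff  v = t·u)
act : ∀ {n} → Transp n → OneLine n → OneLine n
act (tr a b _) u = Vec.map (swap a b) u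

Edge : ∀ {n} → OneLine n → Transp n → OneLine n → Set
Edge u t v = (v ≡ act t u) × (ℓ u ℕ.< ℓ v)

-- A path of length h starting at u is encoded by its label sequence t₁,…,t_h.
-- Its vertices x₀ = u, x_k = t_k x_{k-1}.
vertices : ∀ {n h} → OneLine n → Vec (Transp n) h → Vec (OneLine n) (suc h)
vertices u [] = u ∷ []
vertices u (t ∷ ts) = u ∷ vertices (act t u) ts

data IsPath {n : ℕ} : ∀ {h} → OneLine n → Vec (Transp n) h → OneLine n → Set where
  stop : ∀ {u} → IsPath u [] u
  step : ∀ {h u x v t} {ts : Vec (Transp n) h} →
         Edge u t x → IsPath x ts v → IsPath u (t ∷ ts) v

-- One flip f_i relating p and q in P_h(u,v): q is a path from u to v whose
-- vertex sequence agrees with that of p except at exactly one vertex x_i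
-- (necessarily interior, since endpoints are fixed).  Since between two
-- elements there are 0 or 2 paths of length 2, q is exactly f_i(p).
Flip : ∀ {n h} → OneLine n → OneLine n → Vec (Transp n) h → Vec (Transp n) h → Set
Flip {n} {h} u v p q =
  IsPath u q v ×
  ∃ λ (i : Fin (suc h)) →
    (¬ lookup (vertices u p) i ≡ lookup (vertices u q) i) ×
    (∀ (j : Fin (suc h)) → ¬ j ≡ i → lookup (vertices u p) j ≡ lookup (vertices u q) j)

-- q lies in the flipclass of p (orbit under the group generated by the f_i;
-- each f_i is an involution so the reflexive-transitive closure suffices).
SameFlipclass : ∀ {n h} → OneLine n → OneLine n → Vec (Transp n) h → Vec (Transp n) h → Set
SameFlipclass u v p q = Star (Flip u v) p q

IsReflectionOrdering : ∀ {n} → (Transp n → Transp n → Set) → Set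
IsReflectionOrdering {n} _≼_ =
  IsTotalOrder _≡_ _≼_ ×
  (∀ (a b c : Fin n) (ab : a Fin.< b) (bc : b Fin.< c) →
     let tab = tr a b ab ; tac = tr a c (<-trans ab bc) ; tbc = tr b c bc in
     ((tab ≼ tac) × (tac ≼ tbc)) ⊎ ((tbc ≼ tac) × (tac ≼ tab)))

data Increasing {n : ℕ} (_≼_ : Transp n → Transp n → Set) : ∀ {h} → Vec (Transp n) h → Set where
  inc0 : Increasing _≼_ []
  inc1 : ∀ {t} → Increasing _≼_ (t ∷ [])
  inc2 : ∀ {h s t} {ts : Vec (Transp n) h} →
         s ≼ t → Increasing _≼_ (t ∷ ts) → Increasing _≼_ (s ∷ t ∷ ts)

{-# OPTIONS --safe #-}

-- A path is increasing for a reflection ordering exactly when its labels form a subword of the word W listing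
-- all transpositions in that order.  Two operations on W preserve the number of such subwords in a flipclass:
-- exchanging adjacent commuting transpositions, and reversing an adjacent block (a,b)(a,c)(b,c).  In both cases
-- the paths through the block correspond by flips: if two elements are joined by a path of given length with
-- labels in the block, then exactly one such path is increasing for each of the two orderings of the block.
-- Any two reflection orderings are connected by these operations.  Moving all (x,m), m the largest index,
-- behind the other transpositions leaves them in the order (1,m),(2,m),…, and one recurses on what stands in
-- front: whenever (x,y) has to overtake both (y,m) and (x,m), these two are adjacent because the initial
-- segments of a reflection ordering are biclosed.
module Submission where

open import Defs
open import Data.Nat as ℕ using (ℕ; zero; suc; s≤s; z≤n)
import Data.Nat.Properties as ℕP
open import Data.Fin as Fin using (Fin; zero; suc)
open import Data.Fin.Properties as FinP using (_≟_)
open import Data.Vec as Vec using (Vec; []; _∷_; lookup)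
import Data.Vec.Properties as VecP
import Data.Vec.Relation.Unary.All as VecAll
import Data.Vec.Relation.Unary.AllPairs as VecAllPairs
open import Data.List as List using (List; []; _∷_; _++_; _ʳ++_; length; filter; allFin; cartesianProduct)
import Data.List.Properties as ListP
open import Data.List.Membership.Propositional using (_∈_; find; lose)
import Data.List.Membership.Propositional.Properties as Mem
open import Data.List.Relation.Binary.Permutation.Propositional as Perm using (_↭_; ↭-refl; ↭-sym; ↭-swap)
import Data.List.Relation.Binary.Permutation.Propositional.Properties as PermP
import Data.List.Relation.Binary.Permutation.Setoid.Properties as PermSetoidP
open import Data.List.Relation.Unary.All as All using (All; []; _∷_)
import Data.List.Relation.Unary.All.Properties as AllP
open import Data.List.Relation.Unary.AllPairs as AllPairs using (AllPairs; []; _∷_)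
import Data.List.Relation.Unary.AllPairs.Properties as AllPairsP
open import Data.List.Relation.Unary.Any as Any using (Any; here; there)
import Data.List.Relation.Unary.Any.Properties as AnyP
open import Data.List.Relation.Unary.Linked.Properties using (Linked⇒AllPairs)
open import Data.List.Relation.Unary.Unique.DecPropositional.Properties using (deduplicate-!)
open import Data.List.Relation.Unary.Unique.Propositional using (Unique)
import Data.List.Relation.Unary.Unique.Propositional.Properties as UniqueP
import Data.List.Sort as Sort
open import Data.Product using (_×_; _,_; ∃; ∃₂; proj₁; proj₂)
open import Data.Sum as Sum using (_⊎_; inj₁; inj₂)
open import Function using (_∘_; id)
open import Function.Bundles using (_⇔_; Equivalence)
open import Relation.Binary.Bundles using (DecTotalOrder)
open import Relation.Binary.Construct.Closure.ReflexiveTransitive as Star using (ε; _◅_; _◅◅_)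
open import Relation.Binary.Definitions using (Decidable; DecidableEquality; tri<; tri≈; tri>)
open import Relation.Binary.PropositionalEquality
  using (_≡_; _≢_; refl; sym; trans; cong; cong₂; subst; subst₂; setoid; module ≡-Reasoning)
open import Relation.Binary.Structures using (IsTotalOrder)
open import Relation.Nullary using (¬_; Dec; yes; no; contradiction)
open import Relation.Nullary.Decidable using (map′; _×-dec_)

open VecAll using ([]; _∷_)
open VecAllPairs using ([]; _∷_)
open Transp

private
  variable
    n h : ℕ

-- Comparing the lengths of lists

module _ {A B : Set} where

  -- A relation takes the place of an injective function, so a partner need only exist for members
  -- of `xs`. The partner of the head is deleted from `ys`; by `inj` nothing else in `xs` is related
  -- to it.
  length-≤-by-injection : (R : A → B → Set) →
    (∀ {x x′ y} → R x y → R x′ y → x ≡ x′) →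
    {xs : List A} {ys : List B} → Unique xs →
    (∀ {x} → x ∈ xs → ∃ λ y → y ∈ ys × R x y) → length xs ℕ.≤ length ys
  length-≤-by-injection R inj {[]} _ _ = z≤n
  length-≤-by-injection R inj {x ∷ xs} {ys} (x∉ ∷ uniq) f
    with y , y∈ , rxy ← f (here refl)
    with as , bs , refl ← Mem.∈-∃++ y∈ =
    subst (suc (length xs) ℕ.≤_) (sym eq) (s≤s (length-≤-by-injection R inj uniq g))
    where
    eq : length (as ++ y ∷ bs) ≡ suc (length (as ++ bs))
    eq = trans (ListP.length-++ as)
           (trans (ℕP.+-suc (length as) (length bs)) (cong suc (sym (ListP.length-++ as))))

    g : ∀ {x′} → x′ ∈ xs → ∃ λ y′ → y′ ∈ as ++ bs × R x′ y′
    g x′∈ with f (there x′∈)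
    ... | y′ , y′∈ , r with Mem.∈-++⁻ as y′∈
    ...   | inj₁ y′∈as          = y′ , Mem.∈-++⁺ˡ y′∈as , r
    ...   | inj₂ (there y′∈bs)  = y′ , Mem.∈-++⁺ʳ as y′∈bs , r
    ...   | inj₂ (here refl)    = contradiction (inj rxy r) (All.lookup x∉ x′∈)

-- Transpositions as maps on the index set

Transp-≡ : {s t : Transp n} → fst s ≡ fst t → snd s ≡ snd t → s ≡ t
Transp-≡ {s = tr a b p} {tr _ _ q} refl refl = cong (tr a b) (FinP.<-irrelevant p q)

fst≢snd : (t : Transp n) → fst t ≢ snd t
fst≢snd t eq = FinP.<-irrefl eq (lt t)

swap-fst : (a b : Fin n) → swap a b a ≡ b
swap-fst a b with a ≟ a
... | yes _  = refl
... | no a≢a = contradiction refl a≢a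

swap-snd : (a b : Fin n) → swap a b b ≡ a
swap-snd a b with b ≟ a
... | yes b≡a = b≡a
... | no _ with b ≟ b
...   | yes _  = refl
...   | no b≢b = contradiction refl b≢b

swap-other : {a b x : Fin n} → x ≢ a → x ≢ b → swap a b x ≡ x
swap-other {a = a} {b} {x} x≢a x≢b with x ≟ a
... | yes x≡a = contradiction x≡a x≢a
... | no _ with x ≟ b
...   | yes x≡b = contradiction x≡b x≢b
...   | no _    = refl

data SwapView (a b x : Fin n) : Set where
  at-fst : x ≡ a → SwapView a b x
  at-snd : x ≡ b → SwapView a b x
  off    : x ≢ a → x ≢ b → SwapView a b x

swapView : (a b x : Fin n) → SwapView a b x
swapView a b x with x ≟ a | x ≟ b
... | yes x≡a | _       = at-fst x≡a
... | no _    | yes x≡b = at-snd x≡b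
... | no x≢a  | no x≢b  = off x≢a x≢b

swap-involutive : (a b x : Fin n) → swap a b (swap a b x) ≡ x
swap-involutive a b x with swapView a b x
... | at-fst refl  = trans (cong (swap a b) (swap-fst a b)) (swap-snd a b)
... | at-snd refl  = trans (cong (swap a b) (swap-snd a b)) (swap-fst a b)
... | off x≢a x≢b = trans (cong (swap a b) (swap-other x≢a x≢b)) (swap-other x≢a x≢b)

swap-comm : (a b x : Fin n) → swap a b x ≡ swap b a x
swap-comm a b x with swapView a b x
... | at-fst refl  = trans (swap-fst a b) (sym (swap-snd b a))
... | at-snd refl  = trans (swap-snd a b) (sym (swap-fst b a))
... | off x≢a x≢b = trans (swap-other x≢a x≢b) (sym (swap-other x≢b x≢a))

-- Conjugating (a c) by (a b) gives (b c). Permuting the letters and using `swap-comm`, one gets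
-- every coincidence among products of two different transpositions of `a`, `b`, `c`.
swap-rotate : {a b c : Fin n} → a ≢ b → b ≢ c → a ≢ c → ∀ x →
  swap a c (swap a b x) ≡ swap a b (swap b c x)
swap-rotate {a = a} {b} {c} a≢b b≢c a≢c x with x ≟ c
... | yes refl = trans (trans (cong (swap a c) (swap-other (a≢c ∘ sym) (b≢c ∘ sym))) (swap-snd a c))
                   (sym (trans (cong (swap a b) (swap-snd b c)) (swap-snd a b)))
... | no x≢c with swapView a b x
...   | at-fst refl = trans (trans (cong (swap a c) (swap-fst a b)) (swap-other (a≢b ∘ sym) b≢c))
                        (sym (trans (cong (swap a b) (swap-other a≢b x≢c)) (swap-fst a b)))
...   | at-snd refl = trans (trans (cong (swap a c) (swap-snd a b)) (swap-fst a c))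
                        (sym (trans (cong (swap a b) (swap-fst b c)) (swap-other (a≢c ∘ sym) (b≢c ∘ sym))))
...   | off x≢a x≢b = trans (trans (cong (swap a c) (swap-other x≢a x≢b)) (swap-other x≢a x≢c))
                        (sym (trans (cong (swap a b) (swap-other x≢b x≢c)) (swap-other x≢a x≢b)))

swap-disjoint : {a b c d : Fin n} → a ≢ c → a ≢ d → b ≢ c → b ≢ d → ∀ x →
  swap a b (swap c d x) ≡ swap c d (swap a b x)
swap-disjoint {a = a} {b} {c} {d} a≢c a≢d b≢c b≢d x with swapView a b x
... | at-fst refl = trans (trans (cong (swap a b) (swap-other a≢c a≢d)) (swap-fst a b))
                      (sym (trans (cong (swap c d) (swap-fst a b)) (swap-other b≢c b≢d)))
... | at-snd refl = trans (trans (cong (swap a b) (swap-other b≢c b≢d)) (swap-snd a b))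
                      (sym (trans (cong (swap c d) (swap-snd a b)) (swap-other a≢c a≢d)))
... | off x≢a x≢b with swapView c d x
...   | at-fst refl = trans (trans (cong (swap a b) (swap-fst c d)) (swap-other (a≢d ∘ sym) (b≢d ∘ sym)))
                        (sym (trans (cong (swap c d) (swap-other x≢a x≢b)) (swap-fst c d)))
...   | at-snd refl = trans (trans (cong (swap a b) (swap-snd c d)) (swap-other (a≢c ∘ sym) (b≢c ∘ sym)))
                        (sym (trans (cong (swap c d) (swap-other x≢a x≢b)) (swap-snd c d)))
...   | off x≢c x≢d = trans (trans (cong (swap a b) (swap-other x≢c x≢d)) (swap-other x≢a x≢b))
                        (sym (trans (cong (swap c d) (swap-other x≢a x≢b)) (swap-other x≢c x≢d)))

infixr 8 _·_

_·_ : Transp n → Fin n → Fin n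
t · x = swap (fst t) (snd t) x

-- Permutations and the positions of their values

record Inverse (u : OneLine n) : Set where
  field
    pos        : Fin n → Fin n
    lookup-pos : ∀ x → lookup u (pos x) ≡ x
    pos-lookup : ∀ i → pos (lookup u i) ≡ i

  pos-injective : ∀ {x y} → pos x ≡ pos y → x ≡ y
  pos-injective eq = trans (sym (lookup-pos _)) (trans (cong (lookup u) eq) (lookup-pos _))

open Inverse

inverse : {u : OneLine n} → IsPerm u → Inverse u
inverse {n} {u} perm = record
  { pos        = λ x → proj₁ (preimage x)
  ; lookup-pos = λ x → proj₂ (preimage x)
  ; pos-lookup = λ i → perm _ _ (proj₂ (preimage (lookup u i)))
  }
  where
  preimage : ∀ x → ∃ λ i → lookup u i ≡ x
  preimage x with FinP.any? (λ i → lookup u i ≟ x)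
  ... | yes found = found
  ... | no  none  = contradiction too-long ℕP.1+n≰n
    where
    -- A missed value, put in front of the values of `u`, would give more distinct elements of
    -- `Fin n` than there are.
    x∉ : All (x ≢_) (List.map (lookup u) (allFin n))
    x∉ = AllP.map⁺ (All.universal (λ i eq → none (i , sym eq)) (allFin n))

    too-long : suc (length (allFin n)) ℕ.≤ length (allFin n)
    too-long = subst (λ k → suc k ℕ.≤ length (allFin n)) (ListP.length-map (lookup u) (allFin n))
      (length-≤-by-injection _≡_ (λ { refl refl → refl })
        (x∉ ∷ UniqueP.map⁺ (perm _ _) (UniqueP.allFin⁺ n))
        (λ {y} _ → y , Mem.∈-allFin y , refl))

lookup-act : (t : Transp n) (u : OneLine n) (i : Fin n) → lookup (act t u) i ≡ t · lookup u i
lookup-act (tr a b _) u i = VecP.lookup-map i (swap a b) u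

act-inverse : {u : OneLine n} (t : Transp n) → Inverse u → Inverse (act t u)
act-inverse {u = u} t P = record
  { pos        = λ x → pos P (t · x)
  ; lookup-pos = λ x → trans (lookup-act t u _)
                   (trans (cong (t ·_) (lookup-pos P (t · x))) (swap-involutive _ _ x))
  ; pos-lookup = λ i → trans (cong (pos P ∘ (t ·_)) (lookup-act t u i))
                   (trans (cong (pos P) (swap-involutive _ _ _)) (pos-lookup P i))
  }

act-act-cong : {s t s′ t′ : Transp n} → (∀ x → t · (s · x) ≡ t′ · (s′ · x)) →
  (u : OneLine n) → act t (act s u) ≡ act t′ (act s′ u)
act-act-cong {s = tr _ _ _} {tr _ _ _} {tr _ _ _} {tr _ _ _} eq u =
  trans (sym (VecP.map-∘ _ _ u)) (trans (VecP.map-cong eq u) (VecP.map-∘ _ _ u))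

act-involutive : (t : Transp n) (u : OneLine n) → act t (act t u) ≡ u
act-involutive t@(tr a b _) u =
  trans (sym (VecP.map-∘ _ _ u)) (trans (VecP.map-cong (swap-involutive a b) u) (VecP.map-id u))

-- Inversions and the direction of Bruhat edges

module _ {n : ℕ} where

  Inversion : OneLine n → Fin n × Fin n → Set
  Inversion u (i , j) = i Fin.< j × lookup u j Fin.< lookup u i

  inversion? : (u : OneLine n) (ij : Fin n × Fin n) → Dec (Inversion u ij)
  inversion? u (i , j) = (i Fin.<? j) ×-dec (lookup u j Fin.<? lookup u i)

  inversions : OneLine n → List (Fin n × Fin n)
  inversions u = filter (inversion? u) (cartesianProduct (allFin n) (allFin n))

  ∈-inversions⁺ : ∀ u {ij} → Inversion u ij → ij ∈ inversions u
  ∈-inversions⁺ u inv = Mem.∈-filter⁺ (inversion? u) (Mem.∈-cartesianProduct⁺ (Mem.∈-allFin _) (Mem.∈-allFin _)) inv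

  ∈-inversions⁻ : ∀ u {ij} → ij ∈ inversions u → Inversion u ij
  ∈-inversions⁻ u ij∈ = proj₂ (Mem.∈-filter⁻ (inversion? u) {xs = cartesianProduct (allFin n) (allFin n)} ij∈)

  inversions-unique : ∀ u → Unique (inversions u)
  inversions-unique u = UniqueP.filter⁺ (inversion? u) (UniqueP.cartesianProduct⁺ (UniqueP.allFin⁺ n) (UniqueP.allFin⁺ n))

-- Since tu = u(u⁻¹tu), exchanging two values amounts to exchanging their positions. This makes the
-- inversions of `u` and `act t u` comparable.
lookup-act-swap : {u : OneLine n} (P : Inverse u) (t : Transp n) (i : Fin n) →
  lookup (act t u) i ≡ lookup u (swap (pos P (fst t)) (pos P (snd t)) i)
lookup-act-swap {u = u} P t i with swapView (pos P (fst t)) (pos P (snd t)) i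
... | at-fst refl = trans (lookup-act t u _)
        (trans (cong (t ·_) (lookup-pos P _)) (trans (swap-fst (fst t) (snd t))
          (trans (sym (lookup-pos P _)) (cong (lookup u) (sym (swap-fst (pos P (fst t)) _))))))
... | at-snd refl = trans (lookup-act t u _)
        (trans (cong (t ·_) (lookup-pos P _)) (trans (swap-snd (fst t) (snd t))
          (trans (sym (lookup-pos P _)) (cong (lookup u) (sym (swap-snd _ (pos P (snd t))))))))
... | off i≢ i≢′ = trans (lookup-act t u _)
        (trans (swap-other (i≢ ∘ position) (i≢′ ∘ position)) (cong (lookup u) (sym (swap-other i≢ i≢′))))
  where
  position : ∀ {x} → lookup u i ≡ x → i ≡ pos P x
  position refl = sym (pos-lookup P i)

Up : OneLine n → Transp n → Set
Up u t = ℓ u ℕ.< ℓ (act t u)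

up? : (u : OneLine n) (t : Transp n) → Dec (Up u t)
up? u t = ℓ u ℕ.<? ℓ (act t u)

module _ {u : OneLine n} (P : Inverse u) (t : Transp n) (i<j : pos P (fst t) Fin.< pos P (snd t)) where

  private
    a b i j : Fin n
    a = fst t
    b = snd t
    i = pos P a
    j = pos P b

    τ : Fin n → Fin n
    τ = swap i j

    u′ : OneLine n
    u′ = act t u

    -- The injection applies τ to both positions when this keeps their order, and is the identity otherwise.
    data Image : Fin n × Fin n → Fin n × Fin n → Set where
      moved : ∀ {k l} → k Fin.< l → τ k Fin.< τ l → Image (k , l) (τ k , τ l)
      fixed : ∀ {k l} → ¬ (τ k Fin.< τ l) → Image (k , l) (k , l)

    -- Two moved pairs are compared by applying `τ` once more. A moved pair is never the image of a
    -- fixed one, because `τ` takes it back to an ordered pair.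
    image-injective′ : ∀ {x x′ y y′} → Image x y → Image x′ y′ → y ≡ y′ → x ≡ x′
    image-injective′ (moved {k} {l} _ _) (moved {k′} {l′} _ _) eq = cong₂ _,_
      (trans (sym (swap-involutive i j k)) (trans (cong (τ ∘ proj₁) eq) (swap-involutive i j k′)))
      (trans (sym (swap-involutive i j l)) (trans (cong (τ ∘ proj₂) eq) (swap-involutive i j l′)))
    image-injective′ (moved k<l _) (fixed ≮) refl =
      contradiction (subst₂ Fin._<_ (sym (swap-involutive i j _)) (sym (swap-involutive i j _)) k<l) ≮
    image-injective′ (fixed ≮) (moved k<l _) refl =
      contradiction (subst₂ Fin._<_ (sym (swap-involutive i j _)) (sym (swap-involutive i j _)) k<l) ≮
    image-injective′ (fixed _) (fixed _) eq = eq

    u′-values : ∀ k l {x y} → lookup u (τ l) ≡ x → lookup u (τ k) ≡ y → x Fin.< y → lookup u′ l Fin.< lookup u′ k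
    u′-values k l refl refl = subst₂ Fin._<_ (sym (lookup-act-swap P t l)) (sym (lookup-act-swap P t k))

    value-at-i : ∀ k → τ k ≡ i → lookup u (τ k) ≡ a
    value-at-i k eq = trans (cong (lookup u) eq) (lookup-pos P a)

    value-at-j : ∀ k → τ k ≡ j → lookup u (τ k) ≡ b
    value-at-j k eq = trans (cong (lookup u) eq) (lookup-pos P b)

    -- For k < l, `τ` can reverse the order only if k is `i` or l is `j`. The value at `i` rises
    -- from `a` to `b` and the value at `j` drops from `b` to `a`, so an inversion there persists
    -- and (i, j) becomes one.
    fixed-inversion : ∀ {k l} → k Fin.< l → ¬ (τ k Fin.< τ l) →
      (k ≡ i × l ≡ j) ⊎ lookup u l Fin.< lookup u k → lookup u′ l Fin.< lookup u′ k
    fixed-inversion {k} {l} k<l ≮ (inj₁ (refl , refl)) =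
      u′-values i j (value-at-i j (swap-snd i j)) (value-at-j i (swap-fst i j)) (lt t)
    fixed-inversion {k} {l} k<l ≮ (inj₂ inv) with swapView i j k | swapView i j l
    ... | at-fst refl | at-fst refl = contradiction k<l (FinP.<-irrefl refl)
    ... | at-fst refl | at-snd refl =
          u′-values i j (value-at-i j (swap-snd i j)) (value-at-j i (swap-fst i j)) (lt t)
    ... | at-fst refl | off l≢i l≢j =
          u′-values i l (cong (lookup u) (swap-other l≢i l≢j)) (value-at-j i (swap-fst i j))
            (FinP.<-trans (subst (lookup u l Fin.<_) (lookup-pos P a) inv) (lt t))
    ... | at-snd refl | at-fst refl = contradiction k<l (FinP.<-asym i<j)
    ... | at-snd refl | at-snd refl = contradiction k<l (FinP.<-irrefl refl)
    ... | at-snd refl | off l≢i l≢j =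
          contradiction (subst₂ Fin._<_ (sym (swap-snd i j)) (sym (swap-other l≢i l≢j)) (FinP.<-trans i<j k<l)) ≮
    ... | off k≢i k≢j | at-fst refl =
          contradiction (subst₂ Fin._<_ (sym (swap-other k≢i k≢j)) (sym (swap-fst i j)) (FinP.<-trans k<l i<j)) ≮
    ... | off k≢i k≢j | at-snd refl =
          u′-values k j (value-at-i j (swap-snd i j)) (cong (lookup u) (swap-other k≢i k≢j))
            (FinP.<-trans (lt t) (subst (Fin._< lookup u k) (lookup-pos P b) inv))
    ... | off k≢i k≢j | off l≢i l≢j =
          contradiction (subst₂ Fin._<_ (sym (swap-other k≢i k≢j)) (sym (swap-other l≢i l≢j)) k<l) ≮

    image : ∀ {k l} → k Fin.< l → (k ≡ i × l ≡ j) ⊎ lookup u l Fin.< lookup u k →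
      ∃ λ y → y ∈ inversions u′ × Image (k , l) y
    image {k} {l} k<l inv with τ k Fin.<? τ l
    ... | no  ≮ = _ , ∈-inversions⁺ u′ (k<l , fixed-inversion k<l ≮ inv) , fixed ≮
    ... | yes τ< with inv
    ...   | inj₁ (refl , refl) =
            contradiction (subst₂ Fin._<_ (swap-fst i j) (swap-snd i j) τ<) (FinP.<-asym i<j)
    ...   | inj₂ ul<uk = _ , ∈-inversions⁺ u′ (τ< ,
              u′-values (τ k) (τ l) (cong (lookup u) (swap-involutive i j l)) (cong (lookup u) (swap-involutive i j k)) ul<uk)
              , moved k<l τ<

    ij-not-inversion : ∀ {kl} → kl ∈ inversions u → (i , j) ≢ kl
    ij-not-inversion kl∈ refl = FinP.<-asym (lt t)
      (subst₂ Fin._<_ (lookup-pos P b) (lookup-pos P a) (proj₂ (∈-inversions⁻ u kl∈)))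

  -- `Image` injects the inversions of `u` together with (i, j), which is not among them, into those
  -- of `act t u`.
  <⇒Up : Up u t
  <⇒Up = length-≤-by-injection Image (λ r r′ → image-injective′ r r′ refl)
    (All.tabulate ij-not-inversion ∷ inversions-unique u)
    λ { (here refl) → image i<j (inj₁ (refl , refl))
      ; (there kl∈) → let k<l , inv = ∈-inversions⁻ u kl∈ in image k<l (inj₂ inv) }

-- In `act t u` the two values have exchanged positions. If they stood in the wrong order in `u`,
-- then `t` would go up from `act t u` back to `u`.
Up⇒< : {u : OneLine n} (P : Inverse u) (t : Transp n) → Up u t → pos P (fst t) Fin.< pos P (snd t)
Up⇒< {u = u} P t up with FinP.<-cmp (pos P (fst t)) (pos P (snd t))
... | tri< i<j _ _ = i<j
... | tri≈ _ i≡j _ = contradiction (pos-injective P i≡j) (fst≢snd t)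
... | tri> _ _ j<i = contradiction up (ℕP.<-asym
        (subst (λ w → ℓ (act t u) ℕ.< ℓ w) (act-involutive t u)
          (<⇒Up (act-inverse t P) t
            (subst₂ Fin._<_ (sym (cong (pos P) (swap-fst (fst t) (snd t)))) (sym (cong (pos P) (swap-snd (fst t) (snd t)))) j<i))))

-- Paths, flips and subwords

Up-≡⇒< : {u : OneLine n} (P : Inverse u) (t : Transp n) {x y : Fin n} →
  pos P (fst t) ≡ x → pos P (snd t) ≡ y → Up u t → x Fin.< y
Up-≡⇒< P t refl refl = Up⇒< P t

<⇒Up-≡ : {u : OneLine n} (P : Inverse u) (t : Transp n) {x y : Fin n} →
  pos P (fst t) ≡ x → pos P (snd t) ≡ y → x Fin.< y → Up u t
<⇒Up-≡ P t refl refl = <⇒Up P t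

act-≢ : {u : OneLine n} (P : Inverse u) (s t : Transp n) (x : Fin n) →
  s · x ≢ t · x → act s u ≢ act t u
act-≢ {u = u} P s t x s·x≢t·x eq = s·x≢t·x (begin
  s · x                        ≡⟨ cong (s ·_) (lookup-pos P x) ⟨
  s · lookup u (pos P x)       ≡⟨ lookup-act s u _ ⟨
  lookup (act s u) (pos P x)   ≡⟨ cong (λ w → lookup w (pos P x)) eq ⟩
  lookup (act t u) (pos P x)   ≡⟨ lookup-act t u _ ⟩
  t · lookup u (pos P x)       ≡⟨ cong (t ·_) (lookup-pos P x) ⟩
  t · x                        ∎)
  where open ≡-Reasoning

module _ {u v : OneLine n} {t : Transp n} {ts : Vec (Transp n) h} where

  path-uncons : IsPath u (t ∷ ts) v → Up u t × IsPath (act t u) ts v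
  path-uncons (step (refl , up) path) = up , path

  path-cons : Up u t → IsPath (act t u) ts v → IsPath u (t ∷ ts) v
  path-cons up = step (refl , up)

-- Index 1 is the flipped vertex: index 0 is the common start, and from index 2 on both paths follow
-- the same labels from the same element.
flip-here : {u v : OneLine n} (s t s′ t′ : Transp n) {ts : Vec (Transp n) h} →
  act t (act s u) ≡ act t′ (act s′ u) → act s u ≢ act s′ u →
  IsPath u (s′ ∷ t′ ∷ ts) v → Flip u v (s ∷ t ∷ ts) (s′ ∷ t′ ∷ ts)
flip-here s t s′ t′ {ts} same-end differ path = path , suc zero , differ , λ
  { zero          _  → refl
  ; (suc zero)    j≢ → contradiction refl j≢
  ; (suc (suc j)) _  → cong (λ w → lookup (vertices w ts) j) same-end }

flip-there : {u v : OneLine n} {t : Transp n} → Up u t →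
  (ps qs : Vec (Transp n) h) → Flip (act t u) v ps qs → Flip u v (t ∷ ps) (t ∷ qs)
flip-there up _ _ (path , i , differ , same) = path-cons up path , suc i , differ , λ
  { zero    _  → refl
  ; (suc j) j≢ → same j (j≢ ∘ cong suc) }

SameFlipclass-∷ : {u v : OneLine n} {t : Transp n} → Up u t →
  {ps qs : Vec (Transp n) h} → SameFlipclass (act t u) v ps qs → SameFlipclass u v (t ∷ ps) (t ∷ qs)
SameFlipclass-∷ up = Star.gmap (_ ∷_) (flip-there up _ _)

SameFlipclass-path : {u v : OneLine n} {ps qs : Vec (Transp n) h} →
  IsPath u ps v → SameFlipclass u v ps qs → IsPath u qs v
SameFlipclass-path path ε              = path
SameFlipclass-path path (flip ◅ flips) = SameFlipclass-path (proj₁ flip) flips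

-- The chosen places are recorded, not only the chosen letters, so that rewritings can recurse along
-- the word. `letters` forgets the places.
data Subword {A : Set} : List A → ℕ → Set where
  []   : Subword [] 0
  skip : ∀ {x W h} → Subword W h → Subword (x ∷ W) h
  keep : ∀ {x W h} → Subword W h → Subword (x ∷ W) (suc h)

letters : {A : Set} {W : List A} → Subword W h → Vec A h
letters []               = []
letters (skip m)         = letters m
letters (keep {x = x} m) = x ∷ letters m

-- Flipclass-preserving correspondences between the subwords of two words

Rewriting : List (Transp n) → List (Transp n) → Set
Rewriting {n} W W′ = ∀ {h} → OneLine n → Subword W h → Subword W′ h

PreservesFlipclass : {W W′ : List (Transp n)} → Rewriting W W′ → Set
PreservesFlipclass {n} {W} f = ∀ {h} {u v : OneLine n} → Inverse u → (m : Subword W h) →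
  IsPath u (letters m) v → SameFlipclass u v (letters m) (letters (f u m))

-- Demanded on paths only: `reverse₃` merges different subwords, and the original is recovered from
-- which letters go up.
LeftInverse : {W W′ : List (Transp n)} → Rewriting W W′ → Rewriting W′ W → Set
LeftInverse {n} {W} f g = ∀ {h} {u v : OneLine n} → Inverse u → (m : Subword W h) →
  IsPath u (letters m) v → g u (f u m) ≡ m

record _≈_ (W W′ : List (Transp n)) : Set where
  field
    to             : Rewriting W W′
    from           : Rewriting W′ W
    to-preserves   : PreservesFlipclass to
    from-preserves : PreservesFlipclass from
    from∘to        : LeftInverse to from
    to∘from        : LeftInverse from to

open _≈_

≈-refl : {W : List (Transp n)} → W ≈ W
≈-refl = record
  { to = λ _ m → m ; from = λ _ m → m
  ; to-preserves = λ _ _ _ → ε ; from-preserves = λ _ _ _ → ε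
  ; from∘to = λ _ _ _ → refl ; to∘from = λ _ _ _ → refl
  }

≈-sym : {W W′ : List (Transp n)} → W ≈ W′ → W′ ≈ W
≈-sym E = record
  { to = from E ; from = to E
  ; to-preserves = from-preserves E ; from-preserves = to-preserves E
  ; from∘to = to∘from E ; to∘from = from∘to E
  }

module _ {W₁ W₂ W₃ : List (Transp n)} where

  ∘-preserves : {f : Rewriting W₁ W₂} {g : Rewriting W₂ W₃} →
    PreservesFlipclass f → PreservesFlipclass g → PreservesFlipclass (λ u → g u ∘ f u)
  ∘-preserves pf pg P m path =
    pf P m path ◅◅ pg P _ (SameFlipclass-path path (pf P m path))

  ∘-leftInverse : {f : Rewriting W₁ W₂} {f⁻ : Rewriting W₂ W₁} {g : Rewriting W₂ W₃} {g⁻ : Rewriting W₃ W₂} →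
    PreservesFlipclass f → LeftInverse f f⁻ → LeftInverse g g⁻ →
    LeftInverse (λ u → g u ∘ f u) (λ u → f⁻ u ∘ g⁻ u)
  ∘-leftInverse {f⁻ = f⁻} pf lf lg {u = u} P m path =
    trans (cong (f⁻ u) (lg P _ (SameFlipclass-path path (pf P m path)))) (lf P m path)

≈-trans : {W₁ W₂ W₃ : List (Transp n)} → W₁ ≈ W₂ → W₂ ≈ W₃ → W₁ ≈ W₃
≈-trans E F = record
  { to = λ u → to F u ∘ to E u
  ; from = λ u → from E u ∘ from F u
  ; to-preserves = ∘-preserves {f = to E} {to F} (to-preserves E) (to-preserves F)
  ; from-preserves = ∘-preserves {f = from F} {from E} (from-preserves F) (from-preserves E)
  ; from∘to = ∘-leftInverse {f = to E} {from E} {to F} {from F} (to-preserves E) (from∘to E) (from∘to F)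
  ; to∘from = ∘-leftInverse {f = from F} {to F} {from E} {to E} (from-preserves F) (to∘from F) (to∘from E)
  }

module _ {W W′ : List (Transp n)} (t : Transp n) where

  ∷-map : Rewriting W W′ → Rewriting (t ∷ W) (t ∷ W′)
  ∷-map f u (skip m) = skip (f u m)
  ∷-map f u (keep m) = keep (f (act t u) m)

  ∷-preserves : {f : Rewriting W W′} → PreservesFlipclass f → PreservesFlipclass (∷-map f)
  ∷-preserves pf P (skip m) path = pf P m path
  ∷-preserves pf P (keep m) path =
    let up , path′ = path-uncons path in SameFlipclass-∷ up (pf (act-inverse t P) m path′)

module _ {W W′ : List (Transp n)} (t : Transp n) where

  ∷-leftInverse : {f : Rewriting W W′} {g : Rewriting W′ W} →
    LeftInverse f g → LeftInverse (∷-map t f) (∷-map t g)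
  ∷-leftInverse l P (skip m) path = cong skip (l P m path)
  ∷-leftInverse l P (keep m) path = cong keep (l (act-inverse t P) m (proj₂ (path-uncons path)))

≈-∷ : {W W′ : List (Transp n)} (t : Transp n) → W ≈ W′ → (t ∷ W) ≈ (t ∷ W′)
≈-∷ t E = record
  { to = ∷-map t (to E)
  ; from = ∷-map t (from E)
  ; to-preserves = ∷-preserves t {to E} (to-preserves E)
  ; from-preserves = ∷-preserves t {from E} (from-preserves E)
  ; from∘to = ∷-leftInverse t {to E} {from E} (from∘to E)
  ; to∘from = ∷-leftInverse t {from E} {to E} (to∘from E)
  }

-- The elementary moves: commuting pairs and blocks of three

Disjoint : Transp n → Transp n → Set
Disjoint s t = fst s ≢ fst t × fst s ≢ snd t × snd s ≢ fst t × snd s ≢ snd t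

Disjoint-sym : {s t : Transp n} → Disjoint s t → Disjoint t s
Disjoint-sym (p , q , r , s) = p ∘ sym , r ∘ sym , q ∘ sym , s ∘ sym

module _ (s t : Transp n) {W : List (Transp n)} where

  commute : Rewriting (s ∷ t ∷ W) (t ∷ s ∷ W)
  commute u (skip (skip m)) = skip (skip m)
  commute u (skip (keep m)) = keep (skip m)
  commute u (keep (skip m)) = skip (keep m)
  commute u (keep (keep m)) = keep (keep m)

  -- The path changes only when both letters are kept, and then by one flip. Neither letter moves an
  -- entry of the other, so each goes up in either order.
  commute-preserves : Disjoint s t → PreservesFlipclass commute
  commute-preserves _ P (skip (skip m)) path = ε
  commute-preserves _ P (skip (keep m)) path = ε
  commute-preserves _ P (keep (skip m)) path = ε
  commute-preserves (ac , ad , bc , bd) {u = u} P (keep (keep m)) path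
    with up-s , path′ ← path-uncons path
    with up-t , path″ ← path-uncons path′ =
    flip-here s t t s swapped
      -- The middle vertices differ because `s` moves `fst s` while `t` fixes it.
      (act-≢ P s t (fst s) (λ eq → fst≢snd s (sym (trans (sym (swap-fst (fst s) (snd s)))
        (trans eq (swap-other {a = fst t} {snd t} ac ad))))))
      (path-cons (<⇒Up P t t<) (path-cons (<⇒Up-≡ (act-inverse t P) s refl refl s<)
        (subst (λ w → IsPath w (letters m) _) swapped path″)))
    ◅ ε
    where
    swapped : act t (act s u) ≡ act s (act t u)
    swapped = act-act-cong {s = s} {t} {t} {s} (sym ∘ swap-disjoint ac ad bc bd) u

    t< : pos P (fst t) Fin.< pos P (snd t)
    t< = Up-≡⇒< (act-inverse s P) t
      (cong (pos P) (swap-other (ac ∘ sym) (bc ∘ sym))) (cong (pos P) (swap-other (ad ∘ sym) (bd ∘ sym))) up-t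

    s< : pos P (t · fst s) Fin.< pos P (t · snd s)
    s< = subst₂ (λ x y → pos P x Fin.< pos P y) (sym (swap-other ac ad)) (sym (swap-other bc bd)) (Up⇒< P s up-s)

module _ (s t : Transp n) {W : List (Transp n)} where

  commute-leftInverse : LeftInverse (commute s t {W}) (commute t s)
  commute-leftInverse _ (skip (skip m)) _ = refl
  commute-leftInverse _ (skip (keep m)) _ = refl
  commute-leftInverse _ (keep (skip m)) _ = refl
  commute-leftInverse _ (keep (keep m)) _ = refl

≈-commute : {s t : Transp n} → Disjoint s t → {W : List (Transp n)} → (s ∷ t ∷ W) ≈ (t ∷ s ∷ W)
≈-commute {s = s} {t} d = record
  { to = commute s t
  ; from = commute t s
  ; to-preserves = commute-preserves s t d
  ; from-preserves = commute-preserves t s (Disjoint-sym {s = s} {t} d)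
  ; from∘to = commute-leftInverse s t
  ; to∘from = commute-leftInverse t s
  }

-- x, y, z are the reflections of a parabolic subgroup of type A₂ in one of its two reflection orderings;
-- the fields determine which two-letter words are paths from u.
record Dihedral (x y z : Transp n) : Set where
  field
    x≢z   : ∀ {u} → Inverse u → act x u ≢ act z u
    y≢z   : ∀ {u} → Inverse u → act y u ≢ act z u
    x≢y   : ∀ {u} → Inverse u → act x u ≢ act y u
    xy≡zx : ∀ u → act y (act x u) ≡ act x (act z u)
    yz≡zx : ∀ u → act z (act y u) ≡ act x (act z u)
    xz≡zy : ∀ u → act z (act x u) ≡ act y (act z u)
    xz≡yx : ∀ u → act z (act x u) ≡ act x (act y u)
    xy⇒zx : ∀ {u} → Inverse u → Up u x → Up (act x u) y → Up u z × Up (act z u) x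
    yz⇒zx : ∀ {u} → Inverse u → Up u y → Up (act y u) z → Up u z × Up (act z u) x
    yz⇒¬x : ∀ {u} → Inverse u → Up u y → Up (act y u) z → ¬ Up u x
    xz⇒zy : ∀ {u} → Inverse u → Up u x → Up (act x u) z → Up u z → Up (act z u) y
    xz⇒yx : ∀ {u} → Inverse u → Up u x → Up (act x u) z → ¬ Up u z → Up u y × Up (act y u) x
    xy⇒xz : ∀ {u} → Inverse u → Up u x → Up (act x u) y → Up (act x (act z u)) z
    xy⇒yx : ∀ {u} → Inverse u → Up u x → Up (act x u) y → Up (act z u) y × Up (act y (act z u)) x

module _ (x y z : Transp n) {W : List (Transp n)} where

  -- The product is kept. In path order xy = yz = zx and xz = zy = yx, so xy and yz both go to zx,
  -- the only candidate in the reversed block. For xz there are two candidates, zy and yx; the first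
  -- is taken if `z` goes up from `u`, the second otherwise.
  reverse₃ : Rewriting (x ∷ y ∷ z ∷ W) (z ∷ y ∷ x ∷ W)
  reverse₃ u (skip (skip (skip m))) = skip (skip (skip m))
  reverse₃ u (keep (skip (skip m))) = skip (skip (keep m))
  reverse₃ u (skip (keep (skip m))) = skip (keep (skip m))
  reverse₃ u (skip (skip (keep m))) = keep (skip (skip m))
  reverse₃ u (keep (keep (skip m))) = keep (skip (keep m))
  reverse₃ u (skip (keep (keep m))) = keep (skip (keep m))
  reverse₃ u (keep (skip (keep m))) with up? u z
  ... | yes _ = keep (keep (skip m))
  ... | no  _ = skip (keep (keep m))
  reverse₃ u (keep (keep (keep m))) = keep (keep (keep m))

  module _ (D : Dihedral x y z) where
    open Dihedral D

    reverse₃-preserves : PreservesFlipclass reverse₃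
    reverse₃-preserves P (skip (skip (skip m))) path = ε
    reverse₃-preserves P (keep (skip (skip m))) path = ε
    reverse₃-preserves P (skip (keep (skip m))) path = ε
    reverse₃-preserves P (skip (skip (keep m))) path = ε
    reverse₃-preserves {u = u} P (keep (keep (skip m))) path
      with up-x , path′ ← path-uncons path
      with up-y , path″ ← path-uncons path′
      with up-z , up-zx ← xy⇒zx P up-x up-y =
      flip-here x y z x (xy≡zx u) (x≢z P)
        (path-cons up-z (path-cons up-zx (subst (λ w → IsPath w (letters m) _) (xy≡zx u) path″))) ◅ ε
    reverse₃-preserves {u = u} P (skip (keep (keep m))) path
      with up-y , path′ ← path-uncons path
      with up-yz , path″ ← path-uncons path′
      with up-z , up-zx ← yz⇒zx P up-y up-yz =
      flip-here y z z x (yz≡zx u) (y≢z P)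
        (path-cons up-z (path-cons up-zx (subst (λ w → IsPath w (letters m) _) (yz≡zx u) path″))) ◅ ε
    reverse₃-preserves {u = u} P (keep (skip (keep m))) path
      with up-x , path′ ← path-uncons path
      with up-xz , path″ ← path-uncons path′
      with up? u z
    ... | yes up-z = flip-here x z z y (xz≡zy u) (x≢z P)
          (path-cons up-z (path-cons (xz⇒zy P up-x up-xz up-z)
            (subst (λ w → IsPath w (letters m) _) (xz≡zy u) path″))) ◅ ε
    ... | no ¬up-z with up-y , up-yx ← xz⇒yx P up-x up-xz ¬up-z =
          flip-here x z y x (xz≡yx u) (x≢y P)
            (path-cons up-y (path-cons up-yx (subst (λ w → IsPath w (letters m) _) (xz≡yx u) path″))) ◅ ε
    reverse₃-preserves {u = u} {v} P (keep (keep (keep m))) path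
      with up-x , path′ ← path-uncons path
      with up-y , path″ ← path-uncons path′
      with _ , path‴ ← path-uncons path″
      with up-z , up-zx ← xy⇒zx P up-x up-y
      with up-zy , up-zyx ← xy⇒yx P up-x up-y =
      -- Two flips are needed, xyz to zxz to zyx; the middle path is increasing for neither ordering
      -- of the block.
      flip-here x y z x (xy≡zx u) (x≢z P) (path-cons up-z (path-cons up-zx (path-cons {t = z} (xy⇒xz P up-x up-y) end)))
      ◅ flip-there up-z (x ∷ z ∷ letters m) (y ∷ x ∷ letters m) (flip-here x z y x (xz≡yx (act z u)) (x≢y (act-inverse z P))
          (path-cons up-zy (path-cons up-zyx (subst (λ w → IsPath w (letters m) v) (xz≡yx (act z u)) end))))
      ◅ ε
      where
      end : IsPath (act z (act x (act z u))) (letters m) v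
      end = subst (λ w → IsPath (act z w) (letters m) v) (xy≡zx u)
        (proj₂ (path-uncons (proj₂ (path-uncons (proj₂ (path-uncons path))))))

module _ (x y z : Transp n) {W : List (Transp n)} (D : Dihedral x y z) where
  open Dihedral D

  -- On the way back only zx leaves a choice, decided by whether `x` goes up from `u`: it does if
  -- the path was xy, and `yz⇒¬x` excludes it if the path was yz.
  reverse₃-leftInverse : LeftInverse (reverse₃ x y z {W}) (reverse₃ z y x)
  reverse₃-leftInverse P (skip (skip (skip m))) path = refl
  reverse₃-leftInverse P (keep (skip (skip m))) path = refl
  reverse₃-leftInverse P (skip (keep (skip m))) path = refl
  reverse₃-leftInverse P (skip (skip (keep m))) path = refl
  reverse₃-leftInverse {u = u} P (keep (keep (skip m))) path with up? u x
  ... | yes _   = refl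
  ... | no ¬up  = contradiction (proj₁ (path-uncons path)) ¬up
  reverse₃-leftInverse {u = u} P (skip (keep (keep m))) path with up? u x
  ... | yes up  =
        let up-y , path′ = path-uncons path in contradiction up (yz⇒¬x P up-y (proj₁ (path-uncons path′)))
  ... | no _    = refl
  reverse₃-leftInverse {u = u} P (keep (skip (keep m))) path with up? u z
  ... | yes _   = refl
  ... | no _    = refl
  reverse₃-leftInverse P (keep (keep (keep m))) path = refl

≈-reverse₃ : {x y z : Transp n} → Dihedral x y z → Dihedral z y x →
  {W : List (Transp n)} → (x ∷ y ∷ z ∷ W) ≈ (z ∷ y ∷ x ∷ W)
≈-reverse₃ {x = x} {y} {z} D D′ = record
  { to = reverse₃ x y z
  ; from = reverse₃ z y x
  ; to-preserves = reverse₃-preserves x y z D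
  ; from-preserves = reverse₃-preserves z y x D′
  ; from∘to = reverse₃-leftInverse x y z D
  ; to∘from = reverse₃-leftInverse z y x D′
  }

-- The three transpositions of a < b < c

module _ {a b c : Fin n} (a<b : a Fin.< b) (b<c : b Fin.< c) (a<c : a Fin.< c) where

  private
    s r t : Transp n
    s = tr a b a<b
    r = tr a c a<c
    t = tr b c b<c

    a≢b : a ≢ b
    a≢b refl = FinP.<-irrefl refl a<b

    b≢c : b ≢ c
    b≢c refl = FinP.<-irrefl refl b<c

    a≢c : a ≢ c
    a≢c refl = FinP.<-irrefl refl a<c

    sa : s · a ≡ b
    sa = swap-fst a b
    sb : s · b ≡ a
    sb = swap-snd a b
    sc : s · c ≡ c
    sc = swap-other (a≢c ∘ sym) (b≢c ∘ sym)
    ra : r · a ≡ c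
    ra = swap-fst a c
    rb : r · b ≡ b
    rb = swap-other (a≢b ∘ sym) b≢c
    rc : r · c ≡ a
    rc = swap-snd a c
    ta : t · a ≡ a
    ta = swap-other a≢b a≢c
    tb : t · b ≡ c
    tb = swap-fst b c
    tc : t · c ≡ b
    tc = swap-snd b c

    -- The names list letters in path order. The six products of two different letters are the two
    -- 3-cycles, in the classes ts, sr, rt and rs, tr, st.
    ts≡sr : ∀ u → act s (act t u) ≡ act r (act s u)
    ts≡sr = act-act-cong {s = t} {s} {s} {r} (sym ∘ swap-rotate a≢b b≢c a≢c)

    rs≡tr : ∀ u → act s (act r u) ≡ act r (act t u)
    rs≡tr = act-act-cong {s = r} {s} {t} {r} λ x →
      trans (swap-rotate a≢c (b≢c ∘ sym) a≢b x) (cong (r ·_) (swap-comm c b x))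

    ts≡rt : ∀ u → act s (act t u) ≡ act t (act r u)
    ts≡rt = act-act-cong {s = t} {s} {r} {t} λ x →
      trans (swap-comm a b (t · x)) (trans (swap-rotate b≢c (a≢c ∘ sym) (a≢b ∘ sym) x)
        (cong (t ·_) (swap-comm c a x)))

    tr≡st : ∀ u → act r (act t u) ≡ act t (act s u)
    tr≡st = act-act-cong {s = t} {r} {s} {t} λ x → sym (begin
      swap b c (swap a b x)  ≡⟨ cong (t ·_) (swap-comm a b x) ⟩
      swap b c (swap b a x)  ≡⟨ swap-rotate (a≢b ∘ sym) a≢c b≢c x ⟩
      swap b a (swap a c x)  ≡⟨ swap-comm b a (r · x) ⟩
      swap a b (swap a c x)  ≡⟨ swap-rotate a≢c (b≢c ∘ sym) a≢b x ⟩
      swap a c (swap c b x)  ≡⟨ cong (r ·_) (swap-comm c b x) ⟩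
      swap a c (swap b c x)  ∎)
      where open ≡-Reasoning

    module _ {u : OneLine n} (P : Inverse u) where

      _≺_ : Fin n → Fin n → Set
      x ≺ y = pos P x Fin.< pos P y

      ≺-total : ∀ {x y} → x ≢ y → ¬ (x ≺ y) → y ≺ x
      ≺-total {x} {y} x≢y x⊀y with FinP.<-cmp (pos P x) (pos P y)
      ... | tri< x≺y _ _ = contradiction x≺y x⊀y
      ... | tri≈ _ eq _  = contradiction (pos-injective P eq) x≢y
      ... | tri> _ _ y≺x = y≺x

      up₁ : (x : Transp n) → fst x ≺ snd x → Up u x
      up₁ = <⇒Up P

      down₁ : (x : Transp n) → Up u x → fst x ≺ snd x
      down₁ = Up⇒< P

      -- After the letter `x`, a value stands where its image under `x` stood in `u`; the condition
      -- on `y` thus becomes one on positions in `u`.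
      up₂ : (x y : Transp n) {d e : Fin n} → x · fst y ≡ d → x · snd y ≡ e → d ≺ e → Up (act x u) y
      up₂ x y p q = <⇒Up-≡ (act-inverse x P) y (cong (pos P) p) (cong (pos P) q)

      down₂ : (x y : Transp n) {d e : Fin n} → x · fst y ≡ d → x · snd y ≡ e → Up (act x u) y → d ≺ e
      down₂ x y p q = Up-≡⇒< (act-inverse x P) y (cong (pos P) p) (cong (pos P) q)

      up₃ : (x y z : Transp n) {d e : Fin n} → x · y · fst z ≡ d → x · y · snd z ≡ e →
        d ≺ e → Up (act y (act x u)) z
      up₃ x y z p q = <⇒Up-≡ (act-inverse y (act-inverse x P)) z (cong (pos P) p) (cong (pos P) q)

    sa≢ra : s · a ≢ r · a
    sa≢ra eq = b≢c (trans (sym sa) (trans eq ra))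

    sa≢ta : s · a ≢ t · a
    sa≢ta eq = a≢b (sym (trans (sym sa) (trans eq ta)))

    ra≢ta : r · a ≢ t · a
    ra≢ta eq = a≢c (sym (trans (sym ra) (trans eq ta)))

  -- Each `Up` says which of two of `a`, `b`, `c` stands further left in `u`. The implications then
  -- follow from transitivity, asymmetry and totality of the order of positions.
  dihedral : Dihedral s r t
  dihedral = record
    { x≢z   = λ P → act-≢ P s t a sa≢ta
    ; y≢z   = λ P → act-≢ P r t a ra≢ta
    ; x≢y   = λ P → act-≢ P s r a sa≢ra
    ; xy≡zx = λ u → sym (ts≡sr u)
    ; yz≡zx = λ u → sym (ts≡rt u)
    ; xz≡zy = λ u → sym (tr≡st u)
    ; xz≡yx = λ u → sym (trans (rs≡tr u) (tr≡st u))
    ; xy⇒zx = λ P up-s up-sr →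
        up₁ P t (down₂ P s r sa sc up-sr) ,
        up₂ P t s ta tb (FinP.<-trans (down₁ P s up-s) (down₂ P s r sa sc up-sr))
    ; yz⇒zx = λ P up-r up-rt →
        up₁ P t (FinP.<-trans (down₂ P r t rb rc up-rt) (down₁ P r up-r)) ,
        up₂ P t s ta tb (down₁ P r up-r)
    ; yz⇒¬x = λ P up-r up-rt up-s → FinP.<-asym (down₂ P r t rb rc up-rt) (down₁ P s up-s)
    ; xz⇒zy = λ P up-s up-st up-t → up₂ P t r ta tc (down₁ P s up-s)
    ; xz⇒yx = λ P up-s up-st ¬up-t →
        up₁ P r (down₂ P s t sb sc up-st) ,
        up₂ P r s ra rb (≺-total P b≢c (¬up-t ∘ up₁ P t))
    ; xy⇒xz = λ P up-s up-sr →
        up₃ P t s t (trans (cong (t ·_) sb) ta) (trans (cong (t ·_) sc) tc) (down₁ P s up-s)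
    ; xy⇒yx = λ P up-s up-sr →
        up₂ P t r ta tc (down₁ P s up-s) ,
        up₃ P t r s (trans (cong (t ·_) ra) tc) (trans (cong (t ·_) rb) tb) (down₂ P s r sa sc up-sr)
    }

  -- The outer letters exchange roles; undoing a block reversal calls for these laws.
  dihedral-reverse : Dihedral t r s
  dihedral-reverse = record
    { x≢z   = λ P → act-≢ P t s a (sa≢ta ∘ sym)
    ; y≢z   = λ P → act-≢ P r s a (sa≢ra ∘ sym)
    ; x≢y   = λ P → act-≢ P t r a (ra≢ta ∘ sym)
    ; xy≡zx = tr≡st
    ; yz≡zx = λ u → trans (rs≡tr u) (tr≡st u)
    ; xz≡zy = ts≡sr
    ; xz≡yx = ts≡rt
    ; xy⇒zx = λ P up-t up-tr →
        up₁ P s (down₂ P t r ta tc up-tr) ,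
        up₂ P s t sb sc (FinP.<-trans (down₂ P t r ta tc up-tr) (down₁ P t up-t))
    ; yz⇒zx = λ P up-r up-rs →
        up₁ P s (FinP.<-trans (down₁ P r up-r) (down₂ P r s ra rb up-rs)) ,
        up₂ P s t sb sc (down₁ P r up-r)
    ; yz⇒¬x = λ P up-r up-rs up-t → FinP.<-asym (down₂ P r s ra rb up-rs) (down₁ P t up-t)
    ; xz⇒zy = λ P up-t up-ts up-s → up₂ P s r sa sc (down₁ P t up-t)
    ; xz⇒yx = λ P up-t up-ts ¬up-s →
        up₁ P r (down₂ P t s ta tb up-ts) ,
        up₂ P r t rb rc (≺-total P a≢b (¬up-s ∘ up₁ P s))
    ; xy⇒xz = λ P up-t up-tr →
        up₃ P s t s (trans (cong (s ·_) ta) sa) (trans (cong (s ·_) tb) sc) (down₁ P t up-t)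
    ; xy⇒yx = λ P up-t up-tr →
        up₂ P s r sa sc (down₁ P t up-t) ,
        up₃ P s r t (trans (cong (s ·_) rb) sb) (trans (cong (s ·_) rc) sa) (down₂ P t r ta tc up-tr)
    }

-- Connecting reflection orderings

infix 4 _∼_

-- The elementary moves act at the front of a word with an arbitrary rest. Quantifying over that
-- rest makes the relation stable under suffixes; `≈-∷` supplies prefixes.
_∼_ : List (Transp n) → List (Transp n) → Set
W ∼ W′ = ∀ Q → (W ++ Q) ≈ (W′ ++ Q)

∼-refl : {W : List (Transp n)} → W ∼ W
∼-refl Q = ≈-refl

∼-sym : {W W′ : List (Transp n)} → W ∼ W′ → W′ ∼ W
∼-sym e Q = ≈-sym (e Q)

∼-trans : {W₁ W₂ W₃ : List (Transp n)} → W₁ ∼ W₂ → W₂ ∼ W₃ → W₁ ∼ W₃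
∼-trans e f Q = ≈-trans (e Q) (f Q)

∼-++ˡ : (A : List (Transp n)) {W W′ : List (Transp n)} → W ∼ W′ → (A ++ W) ∼ (A ++ W′)
∼-++ˡ []      e   = e
∼-++ˡ (t ∷ A) e Q = ≈-∷ t (∼-++ˡ A e Q)

∼-++ʳ : {W W′ : List (Transp n)} (R : List (Transp n)) → W ∼ W′ → (W ++ R) ∼ (W′ ++ R)
∼-++ʳ {W = W} {W′} R e Q =
  subst₂ _≈_ (sym (ListP.++-assoc W R Q)) (sym (ListP.++-assoc W′ R Q)) (e (R ++ Q))

∼-shift : {t : Transp n} {A R : List (Transp n)} →
  All (λ s → Disjoint s t) A → (A ++ t ∷ R) ∼ (t ∷ A ++ R)
∼-shift         []                    = ∼-refl
∼-shift {A = s ∷ A} (d ∷ ds) = ∼-trans (∼-++ˡ (s ∷ []) (∼-shift ds)) (λ Q → ≈-commute d)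

-- Sorted lists

module _ {A : Set} {R : A → A → Set} where

  AllPairs-++⁻ : ∀ xs {ys} → AllPairs R (xs ++ ys) →
    AllPairs R xs × AllPairs R ys × All (λ x → All (R x) ys) xs
  AllPairs-++⁻ []       rs       = [] , rs , []
  AllPairs-++⁻ (x ∷ xs) (r ∷ rs) =
    let rxs , rys , rxys = AllPairs-++⁻ xs rs
    in AllP.++⁻ˡ xs r ∷ rxs , rys , AllP.++⁻ʳ xs r ∷ rxys

  AllPairs-map-with-All : {P : A → Set} {R′ : A → A → Set} →
    (∀ {x y} → P x → P y → R x y → R′ x y) → ∀ {xs} → All P xs → AllPairs R xs → AllPairs R′ xs
  AllPairs-map-with-All f []       []       = []
  AllPairs-map-with-All f (p ∷ ps) (r ∷ rs) =
    All.zipWith (λ (py , rxy) → f p py rxy) (ps , r) ∷ AllPairs-map-with-All f ps rs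

  -- If the heads differed, each would lie in the tail of the other list, so each would precede the
  -- other.
  sorted-unique : (∀ {x y} → R x y → ¬ R y x) → ∀ {xs ys} → AllPairs R xs → AllPairs R ys →
    (∀ {x} → x ∈ xs → x ∈ ys) → (∀ {x} → x ∈ ys → x ∈ xs) → xs ≡ ys
  sorted-unique asym {[]}     {[]}     _ _ _ _ = refl
  sorted-unique asym {[]}     {y ∷ ys} _ _ _ ⊇ with () ← ⊇ (here refl)
  sorted-unique asym {x ∷ xs} {[]}     _ _ ⊆ _ with () ← ⊆ (here refl)
  sorted-unique asym {x ∷ xs} {y ∷ ys} (x< ∷ sxs) (y< ∷ sys) ⊆ ⊇ with heads
    where
    heads : x ≡ y
    heads with ⊆ (here refl) | ⊇ (here refl)
    ... | here x≡y   | _          = x≡y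
    ... | there _    | here y≡x   = sym y≡x
    ... | there x∈ys | there y∈xs = contradiction (All.lookup x< y∈xs) (asym (All.lookup y< x∈ys))
  ... | refl = cong (x ∷_) (sorted-unique asym sxs sys
        (λ z∈ → tail (All.lookup x< z∈) (⊆ (there z∈))) (λ z∈ → tail (All.lookup y< z∈) (⊇ (there z∈))))
    where
    tail : ∀ {z zs} → R x z → z ∈ x ∷ zs → z ∈ zs
    tail x<z (here refl) = contradiction x<z (asym x<z)
    tail x<z (there z∈)  = z∈

-- Biclosed sets and the order of the transpositions (x, M)

Has : List (Transp n) → Fin n → Fin n → Set
Has S a b = Any (λ t → fst t ≡ a × snd t ≡ b) S

module _ {n : ℕ} where

  -- On the indices below `m`, these are the inversion sets of permutations.
  record Biclosed (m : ℕ) (S : List (Transp n)) : Set where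
    field
      closed   : ∀ {a b c} → a Fin.< b → b Fin.< c → Fin.toℕ c ℕ.< m →
                 Has S a b → Has S b c → Has S a c
      coclosed : ∀ {a b c} → a Fin.< b → b Fin.< c → Fin.toℕ c ℕ.< m →
                 Has S a c → Has S a b ⊎ Has S b c

  open Biclosed

  -- A reflection ordering of the transpositions of [m], read off as the chain of biclosed sets formed by its
  -- initial segments: S is what has been listed so far (in reverse), W what remains.
  data Chain (m : ℕ) : List (Transp n) → List (Transp n) → Set where
    []   : ∀ {S} → Biclosed m S → Chain m S []
    cons : ∀ {S t W} → Biclosed m S → ¬ Has S (fst t) (snd t) → Fin.toℕ (snd t) ℕ.< m →
           Chain m (t ∷ S) W → Chain m S (t ∷ W)

  chain-biclosed : ∀ {m S W} → Chain m S W → Biclosed m S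
  chain-biclosed ([] bi)         = bi
  chain-biclosed (cons bi _ _ _) = bi

  -- Compares the initial segments of a chain with those of the chain that remains once all (x, M)
  -- are taken out.
  Agree : ℕ → List (Transp n) → List (Transp n) → Set
  Agree m S S′ = ∀ {a b} → Fin.toℕ b ℕ.< m → (Has S a b → Has S′ a b) × (Has S′ a b → Has S a b)

  Agree-∷ : ∀ {m S S′} t → Agree m S S′ → Agree m (t ∷ S) (t ∷ S′)
  Agree-∷ t ag b< =
    (λ { (here p) → here p ; (there p) → there (proj₁ (ag b<) p) }) ,
    (λ { (here p) → here p ; (there p) → there (proj₂ (ag b<) p) })

  Agree-biclosed : ∀ {m S S′} → Agree m S S′ → Biclosed (suc m) S → Biclosed m S′
  Agree-biclosed ag bi = record
    { closed = λ a<b b<c c< p q → proj₁ (ag c<) (closed bi a<b b<c (ℕP.m<n⇒m<1+n c<)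
        (proj₂ (ag (ℕP.<-trans b<c c<)) p) (proj₂ (ag c<) q))
    ; coclosed = λ a<b b<c c< p → Sum.map (proj₁ (ag (ℕP.<-trans b<c c<))) (proj₁ (ag c<))
        (coclosed bi a<b b<c (ℕP.m<n⇒m<1+n c<) (proj₂ (ag c<) p))
    }

  -- For x < y, (y, M) stands before (x, M) as long as (x, y) is missing from `S`, and after it once
  -- (x, y) has overtaken both.
  InOrder : List (Transp n) → Transp n → Transp n → Set
  InOrder S s t = fst s ≢ fst t ×
    (fst s Fin.< fst t → Has S (fst s) (fst t)) × (fst t Fin.< fst s → ¬ Has S (fst t) (fst s))

  -- Enlarging `S` can only break the last component, and only when `r` is the transposition of
  -- `fst t` and `fst s`.
  InOrder-∷ : ∀ {S} r s t → ¬ (fst s ≡ snd r × fst t ≡ fst r) → InOrder S s t → InOrder (r ∷ S) s t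
  InOrder-∷ r s t new (≢ , up , down) = ≢ , there ∘ up , λ t<s →
    λ { (here (p , q)) → new (sym q , sym p) ; (there has) → down t<s has }

-- Collecting the transpositions (x, M) behind all others

module _ {n : ℕ} (M : Fin n) where
  open Biclosed

  private
    m : ℕ
    m = Fin.toℕ M

  -- The transpositions (x, M) of S, in the order in which they occur once every other transposition of S has
  -- been moved in front of them.
  record Tops (S T : List (Transp n)) : Set where
    field
      tops    : All (λ t → snd t ≡ M) T
      sound   : ∀ {x} → Any (λ t → fst t ≡ x) T → Has S x M
      complete : ∀ {x} → Has S x M → Any (λ t → fst t ≡ x) T
      ordered : AllPairs (InOrder S) T

  open Tops

  fst<M : ∀ {t : Transp n} → snd t ≡ M → fst t Fin.< M
  fst<M {t} refl = lt t

  tops-below : ∀ {S T} → Tops S T → All (λ t → fst t Fin.< M) T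
  tops-below inv = All.map (λ {t} → fst<M {t}) (tops inv)

  -- A new (x, M) belongs at the end. Let (y, M) be listed already: if y < x, coclosedness puts (y,
  -- x) into `S`, as (x, M) is not there; if x < y, then (x, y) in `S` would by closedness put (x,
  -- M) there.
  tops-snoc : ∀ {S T t} → snd t ≡ M → Biclosed (suc m) S → ¬ Has S (fst t) (snd t) →
    Tops S T → Tops (t ∷ S) (T ++ t ∷ [])
  tops-snoc {S} {T} {t@(tr x _ x<M)} refl bi fresh inv = record
    { tops     = AllP.++⁺ (tops inv) (refl ∷ [])
    ; sound    = λ any → sound′ (AnyP.++⁻ T any)
    ; complete = λ { (here (refl , _)) → AnyP.++⁺ʳ T (here refl)
                   ; (there has) → AnyP.++⁺ˡ (complete inv has) }
    ; ordered  = AllPairsP.++⁺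
        (AllPairs-map-with-All (λ {s} {s′} s<M _ → InOrder-∷ t s s′ (M-new s<M)) (tops-below inv) (ordered inv))
        ([] ∷ [])
        (All.tabulate (λ {s} s∈ → last {s} (fst<M {t = s} (All.lookup (tops inv) s∈)) (sound inv (Any.map (cong fst ∘ sym) s∈)) ∷ []))
    }
    where
    sound′ : ∀ {y} → Any (λ t → fst t ≡ y) T ⊎ Any (λ t → fst t ≡ y) (t ∷ []) → Has (t ∷ S) y M
    sound′ (inj₁ any)         = there (sound inv any)
    sound′ (inj₂ (here refl)) = here (refl , refl)

    M-new : ∀ {a b : Fin n} → a Fin.< M → ¬ (a ≡ M × b ≡ x)
    M-new a<M (refl , _) = FinP.<-irrefl refl a<M

    last : ∀ {s} → fst s Fin.< M → Has S (fst s) M → InOrder (t ∷ S) s t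
    last {s} y<M yM = InOrder-∷ t s t (M-new y<M)
      ( (λ { refl → fresh yM })
      , (λ y<x → Sum.fromInj₁ (λ xM → contradiction xM fresh) (coclosed bi y<x x<M ℕP.≤-refl yM))
      , (λ x<y xy → fresh (closed bi x<y y<M ℕP.≤-refl xy yM)))

  module _ {S : List (Transp n)} (t : Transp n) (bi : Biclosed (suc m) S) (bi′ : Biclosed (suc m) (t ∷ S))
    (fresh : ¬ Has S (fst t) (snd t)) (y<M : snd t Fin.< M) where

    private
      x y : Fin n
      x = fst t
      y = snd t

      x<M : x Fin.< M
      x<M = FinP.<-trans (lt t) y<M

      old : ∀ {a b} → ¬ (x ≡ a × y ≡ b) → Has (t ∷ S) a b → Has S a b
      old ≢ (here eq)   = contradiction eq ≢
      old ≢ (there has) = has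

      <⇒≢ : ∀ {a b : Fin n} → a Fin.< b → a ≢ b
      <⇒≢ a<b refl = FinP.<-irrefl refl a<b

      xy : Has (t ∷ S) x y
      xy = here (refl , refl)

      not-top : ∀ {a} → Has (t ∷ S) a M → Has S a M
      not-top = old (<⇒≢ y<M ∘ proj₂)

    tops-permute : ∀ {T T′} → T ↭ T′ → Tops S T → AllPairs (InOrder (t ∷ S)) T′ → Tops (t ∷ S) T′
    tops-permute T↭T′ inv ord = record
      { tops     = PermP.All-resp-↭ T↭T′ (tops inv)
      ; sound    = there ∘ sound inv ∘ PermP.Any-resp-↭ (↭-sym T↭T′)
      ; complete = PermP.Any-resp-↭ T↭T′ ∘ complete inv ∘ not-top
      ; ordered  = ord
      }

    disjoint : ∀ {s} → snd s ≡ M → fst s ≢ x → fst s ≢ y → Disjoint s t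
    disjoint refl ≢x ≢y = ≢x , ≢y , <⇒≢ x<M ∘ sym , <⇒≢ y<M ∘ sym

    -- If z is the first entry of a transposition between (y, M) and (x, M), biclosedness of `t ∷ S`
    -- is violated. For z < x, (z, x) and (x, y) force (z, y); for x < z < y, (x, y) forces (x, z)
    -- or (z, y); for y < z, (x, y) and (y, z) force (x, z). Each contradicts the assumed order.
    between : ∀ {sy z sx} → fst sy ≡ y → fst sx ≡ x → fst z Fin.< M →
      InOrder S sy z → ¬ InOrder S z sx
    between {z = z} refl refl z<M (y≢z , y<z⇒ , z<y⇒) (z≢x , z<x⇒ , x<z⇒)
      with FinP.<-cmp (fst z) x | FinP.<-cmp (fst z) y
    ... | tri≈ _ z≡x _ | _            = z≢x z≡x
    ... | tri< z<x _ _ | _            = z<y⇒ (FinP.<-trans z<x (lt t))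
          (old (z≢x ∘ sym ∘ proj₁) (closed bi′ z<x (lt t) (ℕP.m<n⇒m<1+n y<M) (there (z<x⇒ z<x)) xy))
    ... | tri> _ _ x<z | tri≈ _ z≡y _ = y≢z (sym z≡y)
    ... | tri> _ _ x<z | tri< z<y _ _ with coclosed bi′ x<z z<y (ℕP.m<n⇒m<1+n y<M) xy
    ...   | inj₁ xz = x<z⇒ x<z (old (<⇒≢ z<y ∘ sym ∘ proj₂) xz)
    ...   | inj₂ zy = z<y⇒ z<y (old (<⇒≢ x<z ∘ proj₁) zy)
    between {z = z} refl refl z<M (y≢z , y<z⇒ , z<y⇒) (z≢x , z<x⇒ , x<z⇒)
        | tri> _ _ x<z | tri> _ _ y<z = x<z⇒ x<z
          (old (<⇒≢ y<z ∘ proj₂) (closed bi′ (lt t) y<z (ℕP.m<n⇒m<1+n z<M) xy (there (y<z⇒ y<z))))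

    -- (x, M) cannot stand before (y, M), as (x, y) would then be in `S` already; and by `between`
    -- nothing separates the two.
    adjacent : ∀ {A sy R} → fst sy ≡ y → Tops S (A ++ sy ∷ R) → Any (λ s → fst s ≡ x) (A ++ sy ∷ R) →
      ∃₂ λ sx R′ → R ≡ sx ∷ R′ × fst sx ≡ x
    adjacent {A} {sy} {R} sy≡y inv x∈
      with _ , sy≺R ∷ ordR , A≺ ← AllPairs-++⁻ A (ordered inv)
      with _ , _ ∷ topsR ← AllP.++⁻ A (tops inv)
      with AnyP.++⁻ A x∈
    ... | inj₁ x∈A with A≺ , s≡x ← All.lookupAny A≺ x∈A = contradiction
          (subst₂ (Has S) s≡x sy≡y
            (proj₁ (proj₂ (All.head A≺)) (subst₂ Fin._<_ (sym s≡x) (sym sy≡y) (lt t)))) fresh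
    ... | inj₂ (here sy≡x) = contradiction (trans (sym sy≡x) sy≡y) (<⇒≢ (lt t))
    ... | inj₂ (there (here z≡x)) = _ , _ , refl , z≡x
    ... | inj₂ (there (there {z} x∈R))
      with sy≺z ∷ _ ← sy≺R | z≺R ∷ _ ← ordR | z-top ∷ _ ← topsR
      with z≺sx , sx≡x ← All.lookupAny z≺R x∈R =
      contradiction z≺sx (between {sy} {z} {Any.lookup x∈R} sy≡y sx≡x (fst<M {t = z} z-top) sy≺z)

    exchange : ∀ {A sy sx R} → fst sy ≡ y → fst sx ≡ x → Tops S (A ++ sy ∷ sx ∷ R) →
      ((A ++ sy ∷ sx ∷ R) ++ t ∷ []) ∼ (t ∷ A ++ sx ∷ sy ∷ R) × Tops (t ∷ S) (A ++ sx ∷ sy ∷ R)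
    exchange {A} {sy@(tr _ _ _)} {sx@(tr _ _ _)} {R} refl refl inv
      with ordA , (sy≺sx ∷ sy≺R) ∷ sx≺R ∷ ordR , A≺ ← AllPairs-++⁻ A (ordered inv)
      with topsA , refl ∷ refl ∷ topsR ← AllP.++⁻ A (tops inv) =
        ∼-trans (subst (_∼ (A ++ sy ∷ sx ∷ t ∷ R)) (sym (ListP.++-assoc A (sy ∷ sx ∷ R) (t ∷ [])))
            (∼-++ˡ A (∼-++ˡ (sy ∷ sx ∷ []) past-R)))
          -- With `t` past `R`, the block (y, M)(x, M)(x, y) is reversed. This puts `t` in front of
          -- it and exchanges the other two, after which `t` commutes past `A`.
          (∼-trans (∼-++ˡ A (λ Q → ≈-reverse₃
              (dihedral-reverse (lt t) (lt sy) (lt sx)) (dihedral (lt t) (lt sy) (lt sx))))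
            (∼-shift disjointA))
      , tops-permute (PermP.++⁺ˡ A (↭-swap sy sx ↭-refl)) inv
          (AllPairsP.++⁺
            (AllPairs-map-with-All (λ {s} {s′} s≢y _ → InOrder-∷ t s s′ (s≢y ∘ proj₁)) A≢y ordA)
            ( (sx≺sy ∷ All.map (λ {s} → InOrder-∷ t sx s (<⇒≢ (lt t) ∘ proj₁)) sx≺R)
            ∷ All.zipWith (λ {s} (sy≺s , s≢x) → InOrder-∷ t sy s (s≢x ∘ proj₂) sy≺s) (sy≺R , R≢x)
            ∷ AllPairs-map-with-All (λ {s} {s′} s≢y _ → InOrder-∷ t s s′ (s≢y ∘ proj₁)) R≢y ordR)
            (All.zipWith (λ { {s} (s≢y , s≺sy ∷ s≺sx ∷ s≺R) →
                All.map (λ {s′} → InOrder-∷ t s s′ (s≢y ∘ proj₁)) (s≺sx ∷ s≺sy ∷ s≺R) })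
              (A≢y , A≺)))
      where
      A≢y : All (λ s → fst s ≢ y) A
      A≢y = All.map (λ { (s≺sy ∷ _) → proj₁ s≺sy }) A≺

      A≢x : All (λ s → fst s ≢ x) A
      A≢x = All.map (λ { (_ ∷ s≺sx ∷ _) → proj₁ s≺sx }) A≺

      R≢y : All (λ s → fst s ≢ y) R
      R≢y = All.map (λ sy≺s → proj₁ sy≺s ∘ sym) sy≺R

      R≢x : All (λ s → fst s ≢ x) R
      R≢x = All.map (λ sx≺s → proj₁ sx≺s ∘ sym) sx≺R

      disjointA : All (λ s → Disjoint s t) A
      disjointA = All.zipWith (λ {s} (s-top , s≢x , s≢y) → disjoint {s} s-top s≢x s≢y)
        (topsA , All.zip (A≢x , A≢y))

      past-R : (R ++ t ∷ []) ∼ (t ∷ R)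
      past-R = subst (λ W → (R ++ t ∷ []) ∼ (t ∷ W)) (ListP.++-identityʳ R)
        (∼-shift (All.zipWith (λ {s} (s-top , s≢x , s≢y) → disjoint {s} s-top s≢x s≢y)
          (topsR , All.zip (R≢x , R≢y))))

      sx≺sy : InOrder (t ∷ S) sx sy
      sx≺sy = <⇒≢ (lt t) , (λ _ → xy) , λ y<x → contradiction y<x (FinP.<-asym (lt t))

    -- `T` cannot contain exactly one of (x, M) and (y, M): coclosedness of `S` excludes the first
    -- alone, closedness of `t ∷ S` the second alone. If it contains neither, `t` commutes with all
    -- of `T`; if both, `exchange` applies.
    pass : ∀ {T} → Tops S T → ∃ λ T′ → (T ++ t ∷ []) ∼ (t ∷ T′) × Tops (t ∷ S) T′
    pass {T} inv with Any.any? (λ s → fst s ≟ x) T | Any.any? (λ s → fst s ≟ y) T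
    ... | yes x∈ | no y∉ with coclosed bi (lt t) y<M ℕP.≤-refl (sound inv x∈)
    ...   | inj₁ xy∈S = contradiction xy∈S fresh
    ...   | inj₂ yM∈S = contradiction (complete inv yM∈S) y∉
    pass {T} inv | no x∉ | yes y∈ = contradiction
      (complete inv (not-top (closed bi′ (lt t) y<M ℕP.≤-refl xy (there (sound inv y∈))))) x∉
    pass {T} inv | no x∉ | no y∉ =
        T
      , subst (λ W → (T ++ t ∷ []) ∼ (t ∷ W)) (ListP.++-identityʳ T)
          (∼-shift (All.zipWith (λ {s} (s-top , s≢x , s≢y) → disjoint {s} s-top s≢x s≢y)
            (tops inv , All.zip (AllP.¬Any⇒All¬ T x∉ , AllP.¬Any⇒All¬ T y∉))))
      , tops-permute ↭-refl inv
          (AllPairs-map-with-All (λ {s} {s′} s≢y _ → InOrder-∷ t s s′ (s≢y ∘ proj₁)) (AllP.¬Any⇒All¬ T y∉) (ordered inv))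
    pass {T} inv | yes x∈ | yes y∈
      with sy , sy∈ , sy≡y ← find y∈
      with A , R , refl ← Mem.∈-∃++ sy∈
      with sx , R′ , refl , sx≡x ← adjacent {A} sy≡y inv x∈ =
      _ , exchange {A} sy≡y sx≡x inv

  -- `T` collects the (x, M) met so far. A further one is appended to `T`; any other letter passes
  -- through `T` and joins the front part `P`.
  separate : ∀ {S S′ T W} → Chain (suc m) S W → Tops S T → Agree m S S′ →
    ∃₂ λ P T′ → (T ++ W) ∼ (P ++ T′) × Chain m S′ P × Agree m (W ʳ++ S) (P ʳ++ S′) × Tops (W ʳ++ S) T′
  separate {T = T} ([] bi) inv ag =
    [] , T , subst (_∼ T) (sym (ListP.++-identityʳ T)) ∼-refl , [] (Agree-biclosed ag bi) , ag , inv
  separate {S} {S′} {T} (cons {t = t} {W} bi fresh y≤M chain) inv ag with snd t ≟ M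
  ... | yes y≡M =
        let P , T′ , T++W∼ , rest = separate chain (tops-snoc y≡M bi fresh inv) ag′
        in P , T′ , subst (_∼ (P ++ T′)) (ListP.++-assoc T (t ∷ []) W) T++W∼ , rest
    where
    ag′ : Agree m (t ∷ S) S′
    ag′ {a} {b} b<M =
      (λ { (here (_ , y≡b)) → contradiction (trans (sym y≡b) y≡M) (λ { refl → FinP.<-irrefl refl b<M })
         ; (there has) → proj₁ (ag b<M) has }) ,
      there ∘ proj₂ (ag b<M)
  ... | no y≢M =
        let T₁ , T∷ʳt∼ , inv₁ = pass t bi (chain-biclosed chain) fresh y<M inv
            P , T′ , T₁++W∼ , chain′ , rest = separate chain inv₁ (Agree-∷ t ag)
        in t ∷ P , T′
         , ∼-trans (subst (_∼ (t ∷ T₁ ++ W)) (ListP.++-assoc T (t ∷ []) W) (∼-++ʳ W T∷ʳt∼))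
             (∼-++ˡ (t ∷ []) T₁++W∼)
         , cons (Agree-biclosed ag bi) (fresh ∘ proj₂ (ag y<M)) y<M chain′
         , rest
    where
    y<M : snd t Fin.< M
    y<M = ℕP.≤∧≢⇒< (ℕP.≤-pred y≤M) (y≢M ∘ FinP.toℕ-injective)

-- Induction on the largest index

Full : ℕ → List (Transp n) → Set
Full {n} m S = ∀ {a b : Fin n} → a Fin.< b → Fin.toℕ b ℕ.< m → Has S a b

module _ (M : Fin n) where
  open Tops

  tops-⊆ : ∀ {S S₁ T T₁} → Full (suc (Fin.toℕ M)) S₁ → Tops M S T → Tops M S₁ T₁ → ∀ {t} → t ∈ T → t ∈ T₁
  tops-⊆ full₁ inv inv₁ {t} t∈
    with refl ← All.lookup (tops inv) t∈
    with s , s∈ , s≡t ← find (complete inv₁ (full₁ (lt t) ℕP.≤-refl)) =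
    subst (_∈ _) (Transp-≡ s≡t (All.lookup (tops inv₁) s∈)) s∈

  -- Once every transposition is listed, `InOrder` allows only increasing first entries. The final
  -- order is therefore the same for all chains.
  tops-sorted : ∀ {S T} → Full (suc (Fin.toℕ M)) S → Tops M S T → AllPairs (λ s t → fst s Fin.< fst t) T
  tops-sorted full inv = AllPairs-map-with-All
    (λ {s} {t} s-top t-top → sorted s t s-top) (tops inv) (ordered inv)
    where
    sorted : ∀ s t → snd s ≡ M → InOrder _ s t → fst s Fin.< fst t
    sorted s t refl (s≢t , _ , t<s⇒) with FinP.<-cmp (fst s) (fst t)
    ... | tri< s<t _ _ = s<t
    ... | tri≈ _ s≡t _ = contradiction s≡t s≢t
    ... | tri> _ _ t<s = contradiction (full t<s (ℕP.m<n⇒m<1+n (lt s))) (t<s⇒ t<s)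

  tops-empty : Tops M [] []
  tops-empty = record { tops = [] ; sound = λ () ; complete = λ () ; ordered = [] }

Agree-full : ∀ {m} {S S′ : List (Transp n)} → Agree m S S′ → Full (suc m) S → Full m S′
Agree-full ag full a<b b<m = proj₁ (ag b<m) (full a<b (ℕP.m<n⇒m<1+n b<m))

Connected : ℕ → ℕ → Set
Connected n m = {W W′ : List (Transp n)} →
  Chain m [] W → Full m (W ʳ++ []) → Chain m [] W′ → Full m (W′ ʳ++ []) → W ∼ W′

connected-suc : (M : Fin n) → Connected n (Fin.toℕ M) → Connected n (suc (Fin.toℕ M))
connected-suc M ih chain full chain′ full′
  with P  , T  , W∼  , chainP  , ag  , inv  ← separate M chain  (tops-empty M) (λ _ → id , id)
     | P′ , T′ , W′∼ , chainP′ , ag′ , inv′ ← separate M chain′ (tops-empty M) (λ _ → id , id)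
  -- Both tails are increasing lists of the same transpositions, hence equal; the front parts are
  -- left to the induction hypothesis.
  with refl ← sorted-unique FinP.<-asym (tops-sorted M full inv) (tops-sorted M full′ inv′)
                (tops-⊆ M full′ inv inv′) (tops-⊆ M full inv′ inv) =
  ∼-trans W∼ (∼-trans
    (∼-++ʳ T (ih chainP (Agree-full ag full) chainP′ (Agree-full ag′ full′)))
    (∼-sym W′∼))

connected : ∀ m → m ℕ.≤ n → Connected n m
-- A letter would have an index below 0, so both words are empty.
connected zero    _   ([] _) _ ([] _) _ = ∼-refl
connected {n} (suc m) m<n = subst (Connected n ∘ suc) eq
  (connected-suc (Fin.fromℕ< m<n) (subst (Connected n) (sym eq) (connected m (ℕP.<⇒≤ m<n))))
  where
  eq : Fin.toℕ (Fin.fromℕ< m<n) ≡ m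
  eq = FinP.toℕ-fromℕ< m<n

-- The word of a reflection ordering

_≟ᵗ_ : DecidableEquality (Transp n)
s ≟ᵗ t = map′ (λ (p , q) → Transp-≡ p q) (λ { refl → refl , refl }) ((fst s ≟ fst t) ×-dec (snd s ≟ snd t))

transpositionList : (ab : Fin n × Fin n) → List (Transp n)
transpositionList (a , b) with a Fin.<? b
... | yes a<b = tr a b a<b ∷ []
... | no  _   = []

transpositions : ∀ n → List (Transp n)
transpositions n =
  List.deduplicate _≟ᵗ_ (List.concatMap transpositionList (cartesianProduct (allFin n) (allFin n)))

∈-transpositions : (t : Transp n) → t ∈ transpositions n
∈-transpositions {n} t = Mem.∈-deduplicate⁺ _≟ᵗ_ (Mem.∈-concatMap⁺ transpositionList
  (lose (Mem.∈-cartesianProduct⁺ (Mem.∈-allFin (fst t)) (Mem.∈-allFin (snd t))) t∈))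
  where
  t∈ : t ∈ transpositionList (fst t , snd t)
  t∈ with fst t Fin.<? snd t
  ... | yes _  = here (Transp-≡ refl refl)
  ... | no ≮   = contradiction (lt t) ≮

Has⇒∈ : {S : List (Transp n)} {a b : Fin n} (a<b : a Fin.< b) → Has S a b → tr a b a<b ∈ S
Has⇒∈ a<b = Any.map (λ (p , q) → Transp-≡ (sym p) (sym q))

∈⇒Has : {S : List (Transp n)} {t : Transp n} → t ∈ S → Has S (fst t) (snd t)
∈⇒Has = Any.map (λ eq → cong fst (sym eq) , cong snd (sym eq))

-- Applying `t` twice returns to `u`. Hence no path repeats a label at once, and increasing paths
-- are strictly increasing.
up-irreflexive : (t : Transp n) (u : OneLine n) → Up u t → ¬ Up (act t u) t
up-irreflexive t u up up′ = ℕP.<-asym up (subst (λ w → ℓ (act t u) ℕ.< ℓ w) (act-involutive t u) up′)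

first-letter-∈ : {A : Set} {W : List A} {x : A} {xs : Vec A h} (m : Subword W (suc h)) →
  letters m ≡ x ∷ xs → x ∈ W
first-letter-∈ (skip m) eq   = there (first-letter-∈ m eq)
first-letter-∈ (keep m) refl = here refl

letters-injective : {A : Set} {W : List A} → Unique W → (m m′ : Subword W h) → letters m ≡ letters m′ → m ≡ m′
letters-injective uniq [] [] eq = refl
letters-injective (_ ∷ uniq) (skip m) (skip m′) eq = cong skip (letters-injective uniq m m′ eq)
letters-injective (_ ∷ uniq) (keep m) (keep m′) eq = cong keep (letters-injective uniq m m′ (VecP.∷-injectiveʳ eq))
letters-injective (x∉ ∷ _) (skip m) (keep m′) eq = contradiction refl (All.lookup x∉ (first-letter-∈ m eq))
letters-injective (x∉ ∷ _) (keep m) (skip m′) eq = contradiction refl (All.lookup x∉ (first-letter-∈ m′ (sym eq)))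

module ReflectionOrdering {n : ℕ} (_≼_ : Transp n → Transp n → Set) (refl-ord : IsReflectionOrdering _≼_) where
  open IsTotalOrder (proj₁ refl-ord) using (total; antisym; reflexive) renaming (trans to ≼-trans)

  -- Totality and decidable equality decide the order, as sorting requires.
  _≼?_ : Decidable _≼_
  s ≼? t with total s t
  ... | inj₁ s≼t = yes s≼t
  ... | inj₂ t≼s with s ≟ᵗ t
  ...   | yes s≡t = yes (reflexive s≡t)
  ...   | no  s≢t = no (λ s≼t → s≢t (antisym s≼t t≼s))

  decTotalOrder : DecTotalOrder _ _ _
  decTotalOrder = record { isDecTotalOrder = record { isTotalOrder = proj₁ refl-ord ; _≟_ = _≟ᵗ_ ; _≤?_ = _≼?_ } }

  open Sort decTotalOrder using (sort; sort-↭; sort-↗)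

  _≺_ : Transp n → Transp n → Set
  s ≺ t = s ≼ t × s ≢ t

  ≺-asym : ∀ {s t} → s ≺ t → ¬ (t ≼ s)
  ≺-asym (s≼t , s≢t) t≼s = s≢t (antisym s≼t t≼s)

  ≺-trans : ∀ {r s t} → r ≺ s → s ≺ t → r ≺ t
  ≺-trans (r≼s , r≢s) (s≼t , s≢t) = ≼-trans r≼s s≼t , λ { refl → r≢s (antisym r≼s s≼t) }

  word : List (Transp n)
  word = sort (transpositions n)

  word-unique : Unique word
  word-unique = PermSetoidP.Unique-resp-↭ (setoid _) (Perm.↭⇒↭ₛ (↭-sym (sort-↭ (transpositions n)))) (deduplicate-! _≟ᵗ_ _)

  word-sorted : AllPairs _≺_ word
  word-sorted = AllPairs.zip (Linked⇒AllPairs ≼-trans (sort-↗ (transpositions n)) , word-unique)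

  ∈-word : ∀ t → t ∈ word
  ∈-word t = PermP.∈-resp-↭ (↭-sym (sort-↭ (transpositions n))) (∈-transpositions t)

  -- In a reflection ordering (a, c) lies between (a, b) and (b, c): it precedes the later of them,
  -- which gives closedness, and follows the earlier, which gives coclosedness.
  down-closed-biclosed : ∀ {S} → (∀ {s t} → s ∈ S → t ≼ s → t ∈ S) → Biclosed n S
  down-closed-biclosed {S} down = record
    { closed   = λ a<b b<c _ ab bc → closed′ a<b b<c (Has⇒∈ a<b ab) (Has⇒∈ b<c bc)
    ; coclosed = λ a<b b<c _ ac → coclosed′ a<b b<c (Has⇒∈ (FinP.<-trans a<b b<c) ac)
    }
    where
    closed′ : ∀ {a b c} (a<b : a Fin.< b) (b<c : b Fin.< c) →
      tr a b a<b ∈ S → tr b c b<c ∈ S → Has S a c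
    closed′ a<b b<c ab bc with proj₂ refl-ord _ _ _ a<b b<c
    ... | inj₁ (_ , ac≼bc) = ∈⇒Has (down bc ac≼bc)
    ... | inj₂ (_ , ac≼ab) = ∈⇒Has (down ab ac≼ab)

    coclosed′ : ∀ {a b c} (a<b : a Fin.< b) (b<c : b Fin.< c) →
      tr a c (FinP.<-trans a<b b<c) ∈ S → Has S a b ⊎ Has S b c
    coclosed′ a<b b<c ac with proj₂ refl-ord _ _ _ a<b b<c
    ... | inj₁ (ab≼ac , _) = inj₁ (∈⇒Has (down ac ab≼ac))
    ... | inj₂ (bc≼ac , _) = inj₂ (∈⇒Has (down ac bc≼ac))

  sorted⇒chain : ∀ S W → AllPairs _≺_ W → (∀ {s t} → s ∈ S → t ∈ W → s ≺ t) →
    (∀ t → t ∈ S ⊎ t ∈ W) → Chain n S W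
  sorted⇒chain S W sorted S≺W cover with down-closed-biclosed {S} down
    where
    down : ∀ {s t} → s ∈ S → t ≼ s → t ∈ S
    down {t = t} s∈S t≼s with cover t
    ... | inj₁ t∈S = t∈S
    ... | inj₂ t∈W = contradiction t≼s (≺-asym (S≺W s∈S t∈W))
  sorted⇒chain S [] _ _ _ | bi = [] bi
  sorted⇒chain S (w ∷ W) (w≺ ∷ sorted) S≺W cover | bi =
    cons bi (λ has → proj₂ (S≺W (Has⇒∈ (lt w) has) (here refl)) refl) (FinP.toℕ<n (snd w))
      (sorted⇒chain (w ∷ S) W sorted
        (λ { (here refl) t∈ → All.lookup w≺ t∈ ; (there s∈) t∈ → S≺W s∈ (there t∈) })
        cover′)
    where
    cover′ : ∀ t → t ∈ w ∷ S ⊎ t ∈ W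
    cover′ t with cover t
    ... | inj₁ t∈S         = inj₁ (there t∈S)
    ... | inj₂ (here t≡w)  = inj₁ (here t≡w)
    ... | inj₂ (there t∈W) = inj₂ t∈W

  word-chain : Chain n [] word
  word-chain = sorted⇒chain [] word word-sorted (λ ()) (λ t → inj₂ (∈-word t))

  word-full : Full n (word ʳ++ [])
  word-full {a} {b} a<b _ = ∈⇒Has {t = tr a b a<b} (AnyP.reverseAcc⁺ [] word (inj₂ (∈-word _)))

  letters-≼ : ∀ {W s} → All (s ≺_) W → (m : Subword W h) → Increasing _≼_ (letters m) →
    Increasing _≼_ (s ∷ letters m)
  letters-≼ []        []       inc = inc1
  letters-≼ (_ ∷ s≺)  (skip m) inc = letters-≼ s≺ m inc
  letters-≼ (s≺t ∷ _) (keep m) inc = inc2 (proj₁ s≺t) inc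

  letters-increasing : ∀ {W} → AllPairs _≺_ W → (m : Subword W h) → Increasing _≼_ (letters m)
  letters-increasing []            []       = inc0
  letters-increasing (_ ∷ sorted)  (skip m) = letters-increasing sorted m
  letters-increasing (w≺ ∷ sorted) (keep m) = letters-≼ w≺ m (letters-increasing sorted m)

  increasing⇒strict : {u v : OneLine n} {ts : Vec (Transp n) h} →
    IsPath u ts v → Increasing _≼_ ts → VecAllPairs.AllPairs _≺_ ts
  increasing⇒strict _    inc0 = []
  increasing⇒strict _    inc1 = [] ∷ []
  increasing⇒strict {u = u} path (inc2 {s = s} s≼t inc)
    with up-s , path′ ← path-uncons path
    with strict@(t≺ ∷ _) ← increasing⇒strict path′ inc =
    (s≺t ∷ VecAll.map (≺-trans s≺t) t≺) ∷ strict
    where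
    s≺t = s≼t , λ { refl → up-irreflexive s u up-s (proj₁ (path-uncons path′)) }

  -- A letter of `W` is kept exactly when it is the next label. The labels after it are strictly
  -- larger, so they are all found in the rest of `W`.
  strict⇒subword : ∀ {W} {ts : Vec (Transp n) h} → AllPairs _≺_ W → VecAllPairs.AllPairs _≺_ ts →
    VecAll.All (_∈ W) ts → ∃ λ (m : Subword W h) → letters m ≡ ts
  strict⇒subword [] [] [] = [] , refl
  strict⇒subword [] (_ ∷ _) (() ∷ _)
  strict⇒subword (_ ∷ sorted) [] [] = let m , eq = strict⇒subword sorted [] [] in skip m , eq
  strict⇒subword {W = w ∷ W} (w≺ ∷ sorted) (s≺ ∷ strict) (here refl ∷ ts∈) =
    let m , eq = strict⇒subword sorted strict (VecAll.map later (VecAll.zip (s≺ , ts∈))) in keep m , cong (w ∷_) eq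
    where
    later : ∀ {t} → w ≺ t × t ∈ w ∷ W → t ∈ W
    later (w≺t , here refl) = contradiction refl (proj₂ w≺t)
    later (_   , there t∈)  = t∈
  strict⇒subword {W = w ∷ W} (w≺ ∷ sorted) (s≺ ∷ strict) (there s∈ ∷ ts∈) =
    let m , eq = strict⇒subword sorted (s≺ ∷ strict) (s∈ ∷ VecAll.map later (VecAll.zip (s≺ , ts∈))) in skip m , eq
    where
    later : ∀ {t} → _ ≺ t × t ∈ w ∷ W → t ∈ W
    later (s≺t , here refl) = contradiction (proj₁ s≺t) (≺-asym (All.lookup w≺ s∈))
    later (_   , there t∈)  = t∈

  increasing⇒subword : {u v : OneLine n} {ts : Vec (Transp n) h} →
    IsPath u ts v → Increasing _≼_ ts → ∃ λ (m : Subword word h) → letters m ≡ ts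
  increasing⇒subword path inc =
    strict⇒subword word-sorted (increasing⇒strict path inc) (VecAll.universal ∈-word _)

-- Comparing the two counts

module _ {n h : ℕ} {u v : OneLine n} (u⁻¹ : Inverse u) {p : Vec (Transp n) h} (p-path : IsPath u p v)
  {_≼_ _≼′_ : Transp n → Transp n → Set} (ord : IsReflectionOrdering _≼_) (ord′ : IsReflectionOrdering _≼′_) where

  private
    module O  = ReflectionOrdering _≼_ ord
    module O′ = ReflectionOrdering _≼′_ ord′

    words-≈ : O.word ≈ O′.word
    words-≈ = subst₂ _≈_ (ListP.++-identityʳ O.word) (ListP.++-identityʳ O′.word)
      (connected n ℕP.≤-refl O.word-chain O.word-full O′.word-chain O′.word-full [])

    -- The path condition is included because `from∘to` is available for paths only.
    Corresponds : Vec (Transp n) h → Vec (Transp n) h → Set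
    Corresponds q q′ = ∃ λ m → letters m ≡ q × IsPath u q v × letters (to words-≈ u m) ≡ q′

    corresponds-injective : ∀ {q₁ q₂ q′} → Corresponds q₁ q′ → Corresponds q₂ q′ → q₁ ≡ q₂
    corresponds-injective (m₁ , refl , path₁ , eq₁) (m₂ , refl , path₂ , eq₂) = cong letters (begin
      m₁                                    ≡⟨ from∘to words-≈ u⁻¹ m₁ path₁ ⟨
      from words-≈ u (to words-≈ u m₁)      ≡⟨ cong (from words-≈ u) (letters-injective O′.word-unique _ _ (trans eq₁ (sym eq₂))) ⟩
      from words-≈ u (to words-≈ u m₂)      ≡⟨ from∘to words-≈ u⁻¹ m₂ path₂ ⟩
      m₂                                    ∎)
      where open ≡-Reasoning

  -- An increasing path is read as a subword of the first word and carried to the second. The result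
  -- stays in the flipclass, and it is increasing as a subword of a sorted word.
  increasing-count-≤ : {L L′ : List (Vec (Transp n) h)} →
    Unique L → (∀ q → (q ∈ L) ⇔ (SameFlipclass u v p q × Increasing _≼_ q)) →
    (∀ q → (q ∈ L′) ⇔ (SameFlipclass u v p q × Increasing _≼′_ q)) →
    length L ℕ.≤ length L′
  increasing-count-≤ uniq L⇔ L′⇔ = length-≤-by-injection Corresponds corresponds-injective uniq λ {q} q∈ →
    let same , inc = Equivalence.to (L⇔ q) q∈
        path       = SameFlipclass-path p-path same
        m , eq     = O.increasing⇒subword path inc
        m-path     = subst (λ w → IsPath u w v) (sym eq) path
        flips      = to-preserves words-≈ u⁻¹ m m-path
    in _ , Equivalence.from (L′⇔ _)
             ( same ◅◅ subst (λ w → SameFlipclass u v w (letters (to words-≈ u m))) eq flips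
             , O′.letters-increasing O′.word-sorted (to words-≈ u m))
         , m , eq , path , refl

theorem4p1 : ∀ (n h : ℕ) (u v : OneLine n) → IsPerm u → IsPerm v →
    (p : Vec (Transp n) h) → IsPath u p v →
    (_≼_ _≼′_ : Transp n → Transp n → Set) →
    IsReflectionOrdering _≼_ → IsReflectionOrdering _≼′_ →
    (L L′ : List (Vec (Transp n) h)) →
    Unique L → (∀ q → (q ∈ L) ⇔ (SameFlipclass u v p q × Increasing _≼_ q)) →
    Unique L′ → (∀ q → (q ∈ L′) ⇔ (SameFlipclass u v p q × Increasing _≼′_ q)) →
    length L ≡ length L′
theorem4p1 n h u v u-perm _ p p-path _≼_ _≼′_ ord ord′ L L′ L-unique L⇔ L′-unique L′⇔ = ℕP.≤-antisym
  (increasing-count-≤ (inverse u-perm) p-path ord ord′ L-unique L⇔ L′⇔)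
  (increasing-count-≤ (inverse u-perm) p-path ord′ ord L′-unique L′⇔ L⇔)
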